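{- Let $d$ and $p$ be integers with $d>p\ge 2$ and let \[ f_{d,p}(m)=\sum_{j=1}^{p}\binom{j+m-2}{j-1}\binom{d-j+m}{d-j}. \] If $d-2p+2\ge 0$, then the set of complex roots of $f_{d,p}$ is \[ \{ -1,-2,\ldots,-(d-p),\alpha_1,\alpha_2,\ldots,\alpha_{p-1}\}, \] where $\alpha_1,\ldots,\alpha_{p-1}$ are real numbers with \[ -(p-1)<\alpha_{p-1}<-(p-2)<\alpha_{p-2}<-(p-3)<\cdots<-1<\alpha_1<0. \]
   Context: For an integer $a\ge 0$, $\binom{a+x}{a}$ denotes the polynomial $\prod_{i=1}^{a}(x+i)/a!$ in $x$; so $\binom{j+m-2}{j-1}=\prod_{i=0}^{j-2}(m+i)/(j-1)!$ and $\binom{d-j+m}{d-j}=\prod_{i=1}^{d-j}(m+i)/(d-j)!$. -}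

module Defs where

open import Data.Integer.Base as ℤ using (ℤ; +_)
open import Data.Nat.Base as ℕ using (ℕ; zero; suc; _∸_; _!)
open import Data.Nat.Properties using (m⊔n≤o⇒m≤o; m⊔n≤o⇒n≤o; _!≢0)
  renaming (≤-refl to ≤ℕ-refl)
open import Data.Product.Base using (∃; _×_; _,_; proj₁; proj₂)
open import Data.Rational.Base
open import Data.Rational.Properties
open import Data.Rational.Solver using (module +-*-Solver)
open import Relation.Binary.PropositionalEquality using (_≡_; refl; sym; trans; cong; cong₂; subst)

------------------------------------------------------------------------
-- Real numbers: Cauchy sequences of rationals, without a prescribed rate
-- of convergence, so that the ring operations are computed termwise.

Cauchy : (ℕ → ℚ) → Set
Cauchy s = ∀ ε → 0ℚ < ε →
  ∃ λ N → ∀ m n → N ℕ.≤ m → N ℕ.≤ n → ∣ s m - s n ∣ < ε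

private
  ½*-pos : ∀ {ε} → 0ℚ < ε → 0ℚ < ½ * ε
  ½*-pos 0<ε = *-monoʳ-<-pos ½ 0<ε

  ½+½ : ∀ ε → ½ * ε + ½ * ε ≡ ε
  ½+½ ε = trans (sym (*-distribʳ-+ ε ½ ½)) (*-identityˡ ε)

  EventuallyBounded : (ℕ → ℚ) → Set
  EventuallyBounded s = ∃ λ B → ∃ λ N → ∀ n → N ℕ.≤ n → ∣ s n ∣ < B

  bound-pos : ∀ {s} → (b : EventuallyBounded s) → 0ℚ < proj₁ b
  bound-pos {s} (B , N , h) = ≤-<-trans (0≤∣p∣ (s N)) (h N ≤ℕ-refl)

  eventually-bounded : ∀ {s} → Cauchy s → EventuallyBounded s
  eventually-bounded {s} cs = 1ℚ + ∣ s N ∣ , N , λ n N≤n → begin-strict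
    ∣ s n ∣                    ≡⟨ cong ∣_∣ (split (s n) (s N)) ⟩
    ∣ (s n - s N) + s N ∣      ≤⟨ ∣p+q∣≤∣p∣+∣q∣ (s n - s N) (s N) ⟩
    ∣ s n - s N ∣ + ∣ s N ∣    <⟨ +-monoˡ-< ∣ s N ∣ (h n N N≤n ≤ℕ-refl) ⟩
    1ℚ + ∣ s N ∣               ∎
    where
    open ≤-Reasoning
    0<1 : 0ℚ < 1ℚ
    0<1 = positive⁻¹ 1ℚ
    N = proj₁ (cs 1ℚ 0<1)
    h = proj₂ (cs 1ℚ 0<1)
    split : ∀ a b → a ≡ (a - b) + b
    split = solve 2 (λ a b → a := (a :- b) :+ b) refl
      where open +-*-Solver

  quotient : ∀ B ε → 0ℚ < B → 0ℚ < ε → ∃ λ δ → 0ℚ < δ × B * δ ≡ ε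
  quotient B ε 0<B 0<ε = 1/ B * ε , positive⁻¹ (1/ B * ε) {{δ-pos}} , B*δ≡ε
    where
    instance
      B-pos : Positive B
      B-pos = positive 0<B
      B-nonZero : NonZero B
      B-nonZero = pos⇒nonZero B
    δ-pos : Positive (1/ B * ε)
    δ-pos = pos*pos⇒pos (1/ B) {{1/pos⇒pos B}} ε {{positive 0<ε}}
    B*δ≡ε : B * (1/ B * ε) ≡ ε
    B*δ≡ε = trans (sym (*-assoc B (1/ B) ε))
                  (trans (cong (_* ε) (*-inverseʳ B)) (*-identityˡ ε))

  product-estimate : ∀ a b c d A B δ → 0ℚ < δ →
    ∣ a ∣ < A → ∣ d ∣ < B → ∣ b - d ∣ < δ → ∣ a - c ∣ < δ →
    ∣ a * b - c * d ∣ < (A + B) * δ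
  product-estimate a b c d A B δ 0<δ a<A d<B b-d<δ a-c<δ = begin-strict
    ∣ a * b - c * d ∣
      ≡⟨ cong ∣_∣ (regroup a b c d) ⟩
    ∣ a * (b - d) + d * (a - c) ∣
      ≤⟨ ∣p+q∣≤∣p∣+∣q∣ (a * (b - d)) (d * (a - c)) ⟩
    ∣ a * (b - d) ∣ + ∣ d * (a - c) ∣
      ≡⟨ cong₂ _+_ (∣p*q∣≡∣p∣*∣q∣ a (b - d)) (∣p*q∣≡∣p∣*∣q∣ d (a - c)) ⟩
    ∣ a ∣ * ∣ b - d ∣ + ∣ d ∣ * ∣ a - c ∣
      ≤⟨ +-mono-≤ (*-monoˡ-≤-nonNeg ∣ a ∣ {{∣-∣-nonNeg a}} (<⇒≤ b-d<δ))
                  (*-monoˡ-≤-nonNeg ∣ d ∣ {{∣-∣-nonNeg d}} (<⇒≤ a-c<δ)) ⟩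
    ∣ a ∣ * δ + ∣ d ∣ * δ
      <⟨ +-mono-< (*-monoˡ-<-pos δ {{positive 0<δ}} a<A)
                  (*-monoˡ-<-pos δ {{positive 0<δ}} d<B) ⟩
    A * δ + B * δ
      ≡⟨ sym (*-distribʳ-+ δ A B) ⟩
    (A + B) * δ ∎
    where
    open ≤-Reasoning
    regroup : ∀ a b c d → a * b - c * d ≡ a * (b - d) + d * (a - c)
    regroup = solve 4 (λ a b c d → a :* b :- c :* d := a :* (b :- d) :+ d :* (a :- c)) refl
      where open +-*-Solver

  *-cauchy-bounded : ∀ s t → Cauchy s → Cauchy t →
    EventuallyBounded s → EventuallyBounded t → Cauchy (λ n → s n * t n)
  *-cauchy-bounded s t cs ct bs@(A , Mₛ , hₛ) bt@(B , Mₜ , hₜ) ε 0<ε =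
    (Mₛ ℕ.⊔ Mₜ) ℕ.⊔ (Nₛ ℕ.⊔ Nₜ) , close
    where
    δ-spec : ∃ λ δ → 0ℚ < δ × (A + B) * δ ≡ ε
    δ-spec = quotient (A + B) ε (+-mono-< (bound-pos {s} bs) (bound-pos {t} bt)) 0<ε
    δ : ℚ
    δ = proj₁ δ-spec
    0<δ : 0ℚ < δ
    0<δ = proj₁ (proj₂ δ-spec)
    Nₛ Nₜ : ℕ
    Nₛ = proj₁ (cs δ 0<δ)
    Nₜ = proj₁ (ct δ 0<δ)
    close : ∀ m n → (Mₛ ℕ.⊔ Mₜ) ℕ.⊔ (Nₛ ℕ.⊔ Nₜ) ℕ.≤ m → (Mₛ ℕ.⊔ Mₜ) ℕ.⊔ (Nₛ ℕ.⊔ Nₜ) ℕ.≤ n →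
      ∣ s m * t m - s n * t n ∣ < ε
    close m n N≤m N≤n =
      subst (∣ s m * t m - s n * t n ∣ <_) (proj₂ (proj₂ δ-spec))
        (product-estimate (s m) (t m) (s n) (t n) A B δ 0<δ
          (hₛ m (m⊔n≤o⇒m≤o Mₛ Mₜ M≤m))
          (hₜ n (m⊔n≤o⇒n≤o Mₛ Mₜ M≤n))
          (proj₂ (ct δ 0<δ) m n (m⊔n≤o⇒n≤o Nₛ Nₜ K≤m) (m⊔n≤o⇒n≤o Nₛ Nₜ K≤n))
          (proj₂ (cs δ 0<δ) m n (m⊔n≤o⇒m≤o Nₛ Nₜ K≤m) (m⊔n≤o⇒m≤o Nₛ Nₜ K≤n)))
      where
      M≤m = m⊔n≤o⇒m≤o (Mₛ ℕ.⊔ Mₜ) (Nₛ ℕ.⊔ Nₜ) N≤m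
      M≤n = m⊔n≤o⇒m≤o (Mₛ ℕ.⊔ Mₜ) (Nₛ ℕ.⊔ Nₜ) N≤n
      K≤m = m⊔n≤o⇒n≤o (Mₛ ℕ.⊔ Mₜ) (Nₛ ℕ.⊔ Nₜ) N≤m
      K≤n = m⊔n≤o⇒n≤o (Mₛ ℕ.⊔ Mₜ) (Nₛ ℕ.⊔ Nₜ) N≤n

-- Only the existence of these moduli of convergence matters.
abstract
  const-cauchy : ∀ q → Cauchy (λ _ → q)
  const-cauchy q ε 0<ε = 0 , λ _ _ _ _ → begin-strict
    ∣ q - q ∣ ≡⟨ cong ∣_∣ (+-inverseʳ q) ⟩
    0ℚ        <⟨ 0<ε ⟩
    ε         ∎
    where open ≤-Reasoning

  +-cauchy : ∀ s t → Cauchy s → Cauchy t → Cauchy (λ n → s n + t n)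
  +-cauchy s t cs ct ε 0<ε = Nₛ ℕ.⊔ Nₜ , λ m n N≤m N≤n → begin-strict
    ∣ (s m + t m) - (s n + t n) ∣     ≡⟨ cong ∣_∣ (regroup (s m) (t m) (s n) (t n)) ⟩
    ∣ (s m - s n) + (t m - t n) ∣     ≤⟨ ∣p+q∣≤∣p∣+∣q∣ (s m - s n) (t m - t n) ⟩
    ∣ s m - s n ∣ + ∣ t m - t n ∣     <⟨ +-mono-<
      (proj₂ (cs (½ * ε) (½*-pos 0<ε)) m n (m⊔n≤o⇒m≤o Nₛ Nₜ N≤m) (m⊔n≤o⇒m≤o Nₛ Nₜ N≤n))
      (proj₂ (ct (½ * ε) (½*-pos 0<ε)) m n (m⊔n≤o⇒n≤o Nₛ Nₜ N≤m) (m⊔n≤o⇒n≤o Nₛ Nₜ N≤n)) ⟩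
    ½ * ε + ½ * ε                     ≡⟨ ½+½ ε ⟩
    ε                                 ∎
    where
    open ≤-Reasoning
    Nₛ Nₜ : ℕ
    Nₛ = proj₁ (cs (½ * ε) (½*-pos 0<ε))
    Nₜ = proj₁ (ct (½ * ε) (½*-pos 0<ε))
    regroup : ∀ a b c d → (a + b) - (c + d) ≡ (a - c) + (b - d)
    regroup = solve 4 (λ a b c d → (a :+ b) :- (c :+ d) := (a :- c) :+ (b :- d)) refl
      where open +-*-Solver

  neg-cauchy : ∀ s → Cauchy s → Cauchy (λ n → - s n)
  neg-cauchy s cs ε 0<ε = proj₁ (cs ε 0<ε) , λ m n N≤m N≤n → begin-strict
    ∣ - s m - - s n ∣   ≡⟨ cong ∣_∣ (sym (neg-distrib-+ (s m) (- s n))) ⟩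
    ∣ - (s m - s n) ∣   ≡⟨ ∣-p∣≡∣p∣ (s m - s n) ⟩
    ∣ s m - s n ∣       <⟨ proj₂ (cs ε 0<ε) m n N≤m N≤n ⟩
    ε                   ∎
    where open ≤-Reasoning

  *-cauchy : ∀ s t → Cauchy s → Cauchy t → Cauchy (λ n → s n * t n)
  *-cauchy s t cs ct =
    *-cauchy-bounded s t cs ct (eventually-bounded cs) (eventually-bounded ct)

record ℝ : Set where
  constructor mkℝ
  field
    seq    : ℕ → ℚ
    cauchy : Cauchy seq
open ℝ public

infix  4 _≃ᴿ_ _<ᴿ_
infixl 6 _+ᴿ_ _-ᴿ_
infixl 7 _*ᴿ_
infix  8 -ᴿ_

record _≃ᴿ_ (x y : ℝ) : Set where
  constructor mk≃ᴿ
  field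
    difference→0 : ∀ ε → 0ℚ < ε → ∃ λ N → ∀ n → N ℕ.≤ n → ∣ seq x n - seq y n ∣ < ε

-- Eventually separated by a fixed positive rational; the termwise strict
-- inequality alone would not respect _≃ᴿ_.
record _<ᴿ_ (x y : ℝ) : Set where
  constructor mk<ᴿ
  field
    gap       : ℚ
    gap-pos   : 0ℚ < gap
    from      : ℕ
    separated : ∀ n → from ℕ.≤ n → seq x n + gap ≤ seq y n

fromℚ : ℚ → ℝ
fromℚ q = mkℝ (λ _ → q) (const-cauchy q)

fromℤ : ℤ → ℝ
fromℤ k = fromℚ (k / 1)

_+ᴿ_ : ℝ → ℝ → ℝ
x +ᴿ y = mkℝ (λ n → seq x n + seq y n) (+-cauchy (seq x) (seq y) (cauchy x) (cauchy y))

-ᴿ_ : ℝ → ℝ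
-ᴿ x = mkℝ (λ n → - seq x n) (neg-cauchy (seq x) (cauchy x))

_-ᴿ_ : ℝ → ℝ → ℝ
x -ᴿ y = x +ᴿ (-ᴿ y)

_*ᴿ_ : ℝ → ℝ → ℝ
x *ᴿ y = mkℝ (λ n → seq x n * seq y n) (*-cauchy (seq x) (seq y) (cauchy x) (cauchy y))

------------------------------------------------------------------------
-- Complex numbers

record ℂ : Set where
  constructor _+i_
  field
    re : ℝ
    im : ℝ
open ℂ public

infix  4 _≃ᶜ_
infix  5 _+i_
infixl 6 _+ᶜ_ _-ᶜ_
infixl 7 _*ᶜ_

record _≃ᶜ_ (z w : ℂ) : Set where
  constructor mk≃ᶜ
  field
    re-≃ : re z ≃ᴿ re w
    im-≃ : im z ≃ᴿ im w

real : ℝ → ℂ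
real x = x +i fromℚ 0ℚ

ratᶜ : ℚ → ℂ
ratᶜ q = real (fromℚ q)

intᶜ : ℤ → ℂ
intᶜ k = real (fromℤ k)

_+ᶜ_ : ℂ → ℂ → ℂ
z +ᶜ w = (re z +ᴿ re w) +i (im z +ᴿ im w)

_-ᶜ_ : ℂ → ℂ → ℂ
z -ᶜ w = (re z -ᴿ re w) +i (im z -ᴿ im w)

_*ᶜ_ : ℂ → ℂ → ℂ
z *ᶜ w = (re z *ᴿ re w -ᴿ im z *ᴿ im w) +i (re z *ᴿ im w +ᴿ im z *ᴿ re w)

-- Sums and products over the index range 1, …, n.

∑₁ : ℕ → (ℕ → ℂ) → ℂ
∑₁ zero    g = intᶜ (+ 0)
∑₁ (suc n) g = ∑₁ n g +ᶜ g (suc n)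

∏₁ : ℕ → (ℕ → ℂ) → ℂ
∏₁ zero    g = intᶜ (+ 1)
∏₁ (suc n) g = ∏₁ n g *ᶜ g (suc n)

------------------------------------------------------------------------
-- The polynomials

-- binom a x is the value at x of the polynomial usually written with upper
-- entry a + x and lower entry a.
binom : ℕ → ℂ → ℂ
binom a x = ratᶜ (_/_ (+ 1) (a !) {{a !≢0}}) *ᶜ ∏₁ a (λ i → x +ᶜ intᶜ (+ i))

-- In the first factor the upper entry j + m - 2 is (j - 1) + (m - 1).
-- The truncated subtractions are exact whenever 1 ≤ j ≤ p ≤ d.
f : (d p : ℕ) → ℂ → ℂ
f d p m = ∑₁ p λ j → binom (j ∸ 1) (m -ᶜ intᶜ (+ 1)) *ᶜ binom (d ∸ j) m

IsRoot : (ℂ → ℂ) → ℂ → Set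
IsRoot g z = g z ≃ᶜ intᶜ (+ 0)

{-# OPTIONS --safe #-}

-- Every summand of f is divisible by (m + 1) ⋯ (m + e), where e = d - p; let g
-- be the quotient, of degree q = p - 1.  By Pascal's rule the unit steps
-- m ↦ m - 1 act on g as finite differences, which evaluates g (- k) for
-- 0 ≤ k ≤ q as (-1)ᵏ times a product of factors that are positive when
-- d - 2p + 2 ≥ 0.  Bisection between consecutive integers therefore yields
-- α₁, …, αq.  Together with -1, …, -e these are q + e = deg f roots of f, any
-- two separated by a strict inequality.  A complex number is apart from at
-- least one of two separated reals, and a factor apart from 0 can be
-- cancelled, so, f (0) being positive, f has no other roots.
module Submission where

-- The step `m ↦ m - 1` is applied only to the argument `u = m - 1` of the first binomials;
-- `y = m + e`, the argument left in the second ones after the division, is held fixed as an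
-- independent variable and receives its value `e - k` at the end. At `u = -1` a single summand
-- survives, and `k` differences lead to `(-1)ᵏ · k(k+1)⋯(2k-1) · (e-k+1)⋯(e-k+r) / (q+e)!` with `r
-- = q - k`. The last product is positive if `k ≤ e` or if it is empty, and `q ≤ e + 1`, which
-- restates the hypothesis, is just enough for that. Constructively, equality of reals cannot be
-- decided and a vanishing product need not exhibit a vanishing factor. Hence no sign of a real
-- number is ever tested: all comparisons are between rational terms of sequences. Since the
-- operations are termwise, `f` at a real number is the sequence of its values at the rational
-- terms. Being nonzero is replaced by being cancellable, which is all that dividing out known roots
-- uses.

open import Algebra.Bundles using (CommutativeRing)
open import Defs

-- Polynomial functions over a commutative ring, and completeness of a list of roots

module PolynomialFunctions {c ℓ} (R : CommutativeRing c ℓ) where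

  open import Algebra.Properties.Ring (CommutativeRing.ring R) using (x≈y⇒x∙y⁻¹≈ε; x∙y⁻¹≈ε⇒x≈y)
  open import Algebra.Solver.Ring.NaturalCoefficients.Default (CommutativeRing.commutativeSemiring R)
    using (solve; _:=_; _:+_; _:*_)
  open import Data.List.Base using ([]; _∷_; length)
  open import Data.List.Relation.Unary.All using (All; []; _∷_)
  open import Data.List.Relation.Unary.AllPairs using (AllPairs; []; _∷_)
  open import Data.List.Relation.Unary.Any using (Any; here; there)
  open import Data.Nat.Base as ℕ using (ℕ; zero; suc)
  open import Data.Nat.Properties using (≤-trans; n≤1+n; m≤n+m)
  open import Data.Product.Base using (∃; _×_; _,_)
  open import Data.Sum.Base using (_⊎_; inj₁; inj₂)
  open import Level using (_⊔_)
  open import Relation.Nullary.Negation using (¬_; contradiction)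

  open CommutativeRing R hiding (zero)
  open import Relation.Binary.Reasoning.Setoid setoid

  -- Divisibility by x - a at every point a replaces coefficients.
  IsPoly : ℕ → (Carrier → Carrier) → Set (c ⊔ ℓ)
  IsPoly zero    g = ∀ x a → g x ≈ g a
  IsPoly (suc n) g = ∀ a → ∃ λ h → IsPoly n h × (∀ x → g x ≈ g a + (x - a) * h x)

  IsPoly-const : ∀ k → IsPoly 0 (λ _ → k)
  IsPoly-const k _ _ = refl

  IsPoly-suc : ∀ n {g} → IsPoly n g → IsPoly (suc n) g
  IsPoly-suc zero    {g} pg a = (λ _ → 0#) , IsPoly-const 0# , λ x → begin
    g x                  ≈⟨ pg x a ⟩
    g a                  ≈⟨ +-identityʳ (g a) ⟨
    g a + 0#             ≈⟨ +-congˡ (zeroʳ (x - a)) ⟨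
    g a + (x - a) * 0#   ∎
  IsPoly-suc (suc n) pg a with pg a
  ... | h , ph , eq = h , IsPoly-suc n ph , eq

  IsPoly-mono : ∀ {m n g} → m ℕ.≤ n → IsPoly m g → IsPoly n g
  IsPoly-mono {n = zero}  ℕ.z≤n       pg = pg
  IsPoly-mono {n = suc n} ℕ.z≤n       pg = IsPoly-suc n (IsPoly-mono ℕ.z≤n pg)
  IsPoly-mono             (ℕ.s≤s m≤n) pg a with pg a
  ... | h , ph , eq = h , IsPoly-mono m≤n ph , eq

  IsPoly-id : IsPoly 1 (λ x → x)
  IsPoly-id a = (λ _ → 1#) , IsPoly-const 1# , λ x → sym (begin
    a + (x - a) * 1#   ≈⟨ +-congˡ (*-identityʳ (x - a)) ⟩
    a + (x - a)        ≈⟨ +-comm a (x - a) ⟩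
    (x - a) + a        ≈⟨ +-assoc x (- a) a ⟩
    x + (- a + a)      ≈⟨ +-congˡ (-‿inverseˡ a) ⟩
    x + 0#             ≈⟨ +-identityʳ x ⟩
    x                  ∎)

  IsPoly-+ : ∀ n {g h} → IsPoly n g → IsPoly n h → IsPoly n (λ x → g x + h x)
  IsPoly-+ zero    pg ph x a = +-cong (pg x a) (ph x a)
  IsPoly-+ (suc n) {g} {h} pg ph a with pg a | ph a
  ... | g′ , pg′ , g≈ | h′ , ph′ , h≈ =
    (λ x → g′ x + h′ x) , IsPoly-+ n pg′ ph′ , λ x → begin
      g x + h x
        ≈⟨ +-cong (g≈ x) (h≈ x) ⟩
      (g a + (x - a) * g′ x) + (h a + (x - a) * h′ x)
        ≈⟨ solve 5 (λ G H t u v → (G :+ t :* u) :+ (H :+ t :* v) := (G :+ H) :+ t :* (u :+ v))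
             refl (g a) (h a) (x - a) (g′ x) (h′ x) ⟩
      (g a + h a) + (x - a) * (g′ x + h′ x) ∎

  IsPoly-*₀ : ∀ n {g h} → IsPoly 0 g → IsPoly n h → IsPoly n (λ x → g x * h x)
  IsPoly-*₀ zero pg ph x a = *-cong (pg x a) (ph x a)
  IsPoly-*₀ (suc n) {g} {h} pg ph a with ph a
  ... | h′ , ph′ , h≈ = (λ x → g x * h′ x) , IsPoly-*₀ n pg ph′ , λ x → begin
      g x * h x
        ≈⟨ *-congˡ (h≈ x) ⟩
      g x * (h a + (x - a) * h′ x)
        ≈⟨ solve 4 (λ G H t v → G :* (H :+ t :* v) := G :* H :+ t :* (G :* v))
             refl (g x) (h a) (x - a) (h′ x) ⟩
      g x * h a + (x - a) * (g x * h′ x)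
        ≈⟨ +-congʳ (*-congʳ (pg x a)) ⟩
      g a * h a + (x - a) * (g x * h′ x) ∎

  -- The quotient at `a` obeys a discrete product rule, `g′ h + g(a) h′`, in which `g(a)` is a
  -- constant.
  IsPoly-* : ∀ m n {g h} → IsPoly m g → IsPoly n h → IsPoly (m ℕ.+ n) (λ x → g x * h x)
  IsPoly-* zero n pg ph = IsPoly-*₀ n pg ph
  IsPoly-* (suc m) zero {g} {h} pg ph a with pg a
  ... | g′ , pg′ , g≈ = (λ x → g′ x * h x) , IsPoly-* m zero pg′ ph , λ x → begin
      g x * h x
        ≈⟨ *-congʳ (g≈ x) ⟩
      (g a + (x - a) * g′ x) * h x
        ≈⟨ solve 4 (λ G H t u → (G :+ t :* u) :* H := G :* H :+ t :* (u :* H))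
             refl (g a) (h x) (x - a) (g′ x) ⟩
      g a * h x + (x - a) * (g′ x * h x)
        ≈⟨ +-congʳ (*-congˡ (ph x a)) ⟩
      g a * h a + (x - a) * (g′ x * h x) ∎
  IsPoly-* (suc m) (suc n) {g} {h} pg ph a with pg a | ph a
  ... | g′ , pg′ , g≈ | h′ , ph′ , h≈ =
    (λ x → g′ x * h x + g a * h′ x) ,
    IsPoly-+ (m ℕ.+ suc n)
      (IsPoly-* m (suc n) pg′ ph)
      (IsPoly-mono (≤-trans (n≤1+n n) (m≤n+m (suc n) m)) (IsPoly-*₀ n (IsPoly-const (g a)) ph′)) ,
    λ x → begin
      g x * h x
        ≈⟨ *-congʳ (g≈ x) ⟩
      (g a + (x - a) * g′ x) * h x
        ≈⟨ solve 4 (λ G H t u → (G :+ t :* u) :* H := G :* H :+ t :* (u :* H))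
             refl (g a) (h x) (x - a) (g′ x) ⟩
      g a * h x + (x - a) * (g′ x * h x)
        ≈⟨ +-congʳ (*-congˡ (h≈ x)) ⟩
      g a * (h a + (x - a) * h′ x) + (x - a) * (g′ x * h x)
        ≈⟨ solve 5 (λ G H t v w → G :* (H :+ t :* v) :+ t :* w := G :* H :+ t :* (w :+ G :* v))
             refl (g a) (h a) (x - a) (h′ x) (g′ x * h x) ⟩
      g a * h a + (x - a) * (g′ x * h x + g a * h′ x) ∎

  -- Divisibility alone yields congruence: `x ≈ a` kills the term `(x - a) * h x`. So `f` needs no
  -- congruence proof of its own.
  IsPoly-cong : ∀ n {g} → IsPoly n g → ∀ {x a} → x ≈ a → g x ≈ g a
  IsPoly-cong zero    pg {x} {a} _   = pg x a
  IsPoly-cong (suc n) {g} pg {x} {a} x≈a with pg a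
  ... | h , _ , eq = begin
    g x                   ≈⟨ eq x ⟩
    g a + (x - a) * h x   ≈⟨ +-congˡ (*-congʳ (x≈y⇒x∙y⁻¹≈ε x≈a)) ⟩
    g a + 0# * h x        ≈⟨ +-congˡ (zeroˡ (h x)) ⟩
    g a + 0#              ≈⟨ +-identityʳ (g a) ⟩
    g a                   ∎

  -- Regularity stands in for being nonzero. It is closed under products and passes to factors in
  -- any commutative ring, without inverses or an apartness relation.
  Cancellable : Carrier → Set (c ⊔ ℓ)
  Cancellable w = ∀ v → w * v ≈ 0# → v ≈ 0#

  Cancellable-resp : ∀ {w w′} → w ≈ w′ → Cancellable w → Cancellable w′
  Cancellable-resp w≈w′ cw v w′v≈0 = cw v (trans (*-congʳ w≈w′) w′v≈0)

  Cancellable-* : ∀ {w w′} → Cancellable w → Cancellable w′ → Cancellable (w * w′)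
  Cancellable-* cw cw′ v ww′v≈0 = cw′ v (cw _ (trans (sym (*-assoc _ _ v)) ww′v≈0))

  Cancellable-factor : ∀ {w w′} → Cancellable (w * w′) → Cancellable w′
  Cancellable-factor {w} {w′} cww′ v w′v≈0 =
    cww′ v (trans (*-assoc w w′ v) (trans (*-congˡ w′v≈0) (zeroʳ w)))

  -- A positive form of `r ≠ s`: cotransitivity of apartness, stated for one pair.
  Separated : Carrier → Carrier → Set (c ⊔ ℓ)
  Separated r s = ∀ z → Cancellable (z - r) ⊎ Cancellable (z - s)

  -- At z = s the second alternative says that 0 is cancellable.
  Separated⇒Cancellable : ∀ {r s} → Separated r s → Cancellable (s - r)
  Separated⇒Cancellable {s = s} sep with sep s
  ... | inj₁ c = c
  ... | inj₂ c = λ v _ → c v (trans (*-congʳ (-‿inverseʳ s)) (zeroˡ v))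

  divide-root : ∀ {n g} → IsPoly (suc n) g → ∀ r → g r ≈ 0# →
    ∃ λ h → IsPoly n h × (∀ x → g x ≈ (x - r) * h x)
  divide-root pg r gr≈0 with pg r
  ... | h , ph , eq = h , ph , λ x →
    trans (eq x) (trans (+-congʳ gr≈0) (+-identityˡ _))

  -- At such an `s` the product `(s - r) * h s` vanishes, and separation makes `s - r` cancellable.
  quotient-roots : ∀ {g h : Carrier → Carrier} {r ss} → (∀ x → g x ≈ (x - r) * h x) →
    All (Separated r) ss → All (λ s → g s ≈ 0#) ss → All (λ s → h s ≈ 0#) ss
  quotient-roots eq []           []           = []
  quotient-roots eq (sep ∷ seps) (gs≈0 ∷ gss) =
    Separated⇒Cancellable sep _ (trans (sym (eq _)) gs≈0) ∷ quotient-roots eq seps gss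

  -- Dividing out all listed roots leaves a constant. It is a factor of `g z₀`, hence cancellable,
  -- and `g z` is its product with the differences `z - r`.
  cancellable-off-roots : ∀ {z₀ z} rs {g} → IsPoly (length rs) g → AllPairs Separated rs →
    All (λ r → g r ≈ 0#) rs → Cancellable (g z₀) →
    All (λ r → Cancellable (z - r)) rs → Cancellable (g z)
  cancellable-off-roots {z₀} {z} [] pg _ _ cg _ = Cancellable-resp (pg z₀ z) cg
  cancellable-off-roots {z₀} {z} (r ∷ rs) pg (sep ∷ seps) (gr≈0 ∷ grs) cg (cr ∷ crs)
    with divide-root pg r gr≈0
  ... | h , ph , eq = Cancellable-resp (sym (eq z)) (Cancellable-* cr
    (cancellable-off-roots rs ph seps (quotient-roots eq sep grs)
      (Cancellable-factor (Cancellable-resp (eq z₀) cg)) crs))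

  private
    -- Replaces the undecidable question whether `z` equals `r`: a single answer in favour of
    -- `z - r` suffices, and otherwise every entry of `ss` has answered for itself.
    near-or-off : ∀ z {r ss} → All (Separated r) ss →
      Cancellable (z - r) ⊎ All (λ s → Cancellable (z - s)) ss
    near-or-off z []           = inj₂ []
    near-or-off z (sep ∷ seps) with sep z | near-or-off z seps
    ... | inj₁ c | _       = inj₁ c
    ... | inj₂ _ | inj₁ c  = inj₁ c
    ... | inj₂ c | inj₂ cs = inj₂ (c ∷ cs)

  -- Write `g z` as `(z - r) * h z`. If `z - r` cancels, `z` is a root of `h` and lies in the tail;
  -- if `z` is off the whole tail, `h z` cancels and `z ≈ r`. Once the list is exhausted `g` is
  -- constant, and its vanishing would make `0#` cancellable.
  roots-complete : ¬ Cancellable 0# → ∀ {z₀ z} rs {g} → IsPoly (length rs) g →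
    AllPairs Separated rs → All (λ r → g r ≈ 0#) rs → Cancellable (g z₀) →
    g z ≈ 0# → Any (z ≈_) rs
  roots-complete 0-reg {z₀} {z} [] pg _ _ cg gz≈0 =
    contradiction (Cancellable-resp (trans (pg z₀ z) gz≈0) cg) 0-reg
  roots-complete 0-reg {z₀} {z} (r ∷ rs) pg (sep ∷ seps) (gr≈0 ∷ grs) cg gz≈0
    with divide-root pg r gr≈0
  ... | h , ph , eq with near-or-off z sep
  ...   | inj₁ z#r = there (roots-complete 0-reg rs ph seps (quotient-roots eq sep grs)
            (Cancellable-factor (Cancellable-resp (eq z₀) cg)) (z#r _ (trans (sym (eq z)) gz≈0)))
  ...   | inj₂ z#rs = here (x∙y⁻¹≈ε⇒x≈y z r
            (cancellable-off-roots rs ph seps (quotient-roots eq sep grs)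
              (Cancellable-factor (Cancellable-resp (eq z₀) cg)) z#rs (z - r)
              (trans (*-comm _ _) (trans (sym (eq z)) gz≈0))))

-- Null sequences of rationals and congruence of the real operations

module NullSequences where

  open import Data.Nat.Base as ℕ using (ℕ)
  open import Data.Nat.Properties using (m⊔n≤o⇒m≤o; m⊔n≤o⇒n≤o)
    renaming (≤-refl to ≤ℕ-refl)
  open import Data.Product.Base using (∃; _×_; _,_)
  open import Data.Rational.Base
  open import Data.Rational.Properties
  open import Data.Rational.Solver using (module +-*-Solver)
  open import Relation.Binary.PropositionalEquality using (_≡_; refl; sym; trans; cong; subst)
  open +-*-Solver using (solve; _:=_; _:+_; _:*_; _:-_; :-_; con)

  -- `x ≃ᴿ y` says that the difference of the two sequences is null, so the closure properties below
  -- are all that the congruences require.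
  Null : (ℕ → ℚ) → Set
  Null s = ∀ ε → 0ℚ < ε → ∃ λ N → ∀ n → N ℕ.≤ n → ∣ s n ∣ < ε

  Bounded : (ℕ → ℚ) → Set
  Bounded s = ∃ λ B → 0ℚ < B × ∃ λ N → ∀ n → N ℕ.≤ n → ∣ s n ∣ < B

  0<* : ∀ {p q} → 0ℚ < p → 0ℚ < q → 0ℚ < p * q
  0<* {p} {q} 0<p 0<q = positive⁻¹ (p * q) {{pos*pos⇒pos p {{positive 0<p}} q {{positive 0<q}}}}

  quotient : ∀ {B ε} → 0ℚ < B → 0ℚ < ε → ∃ λ δ → 0ℚ < δ × B * δ ≡ ε
  quotient {B} {ε} 0<B 0<ε =
    1/ B * ε , 0<* (positive⁻¹ (1/ B) {{1/pos⇒pos B}}) 0<ε ,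
    trans (sym (*-assoc B (1/ B) ε)) (trans (cong (_* ε) (*-inverseʳ B)) (*-identityˡ ε))
    where
    instance
      B-pos : Positive B
      B-pos = positive 0<B
      B-nonZero : NonZero B
      B-nonZero = pos⇒nonZero B

  null-cong : ∀ {s t} → (∀ n → s n ≡ t n) → Null s → Null t
  null-cong s≡t ns ε 0<ε with ns ε 0<ε
  ... | N , h = N , λ n N≤n → subst (λ q → ∣ q ∣ < ε) (s≡t n) (h n N≤n)

  null-0 : Null (λ _ → 0ℚ)
  null-0 ε 0<ε = 0 , λ _ _ → 0<ε

  null-+ : ∀ {s t} → Null s → Null t → Null (λ n → s n + t n)
  null-+ {s} {t} ns nt ε 0<ε with ns (½ * ε) (0<* (positive⁻¹ ½) 0<ε) | nt (½ * ε) (0<* (positive⁻¹ ½) 0<ε)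
  ... | M , hs | N , ht = M ℕ.⊔ N , λ n M⊔N≤n → begin-strict
    ∣ s n + t n ∣       ≤⟨ ∣p+q∣≤∣p∣+∣q∣ (s n) (t n) ⟩
    ∣ s n ∣ + ∣ t n ∣   <⟨ +-mono-< (hs n (m⊔n≤o⇒m≤o M N M⊔N≤n)) (ht n (m⊔n≤o⇒n≤o M N M⊔N≤n)) ⟩
    ½ * ε + ½ * ε       ≡⟨ solve 1 (λ ε → con ½ :* ε :+ con ½ :* ε := ε) refl ε ⟩
    ε                   ∎
    where open ≤-Reasoning

  null-neg : ∀ {s} → Null s → Null (λ n → - s n)
  null-neg {s} ns ε 0<ε with ns ε 0<ε
  ... | N , h = N , λ n N≤n → subst (_< ε) (sym (∣-p∣≡∣p∣ (s n))) (h n N≤n)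

  null-* : ∀ {s t} → Bounded s → Null t → Null (λ n → s n * t n)
  null-* {s} {t} (B , 0<B , M , hs) nt ε 0<ε with quotient 0<B 0<ε
  ... | δ , 0<δ , Bδ≡ε with nt δ 0<δ
  ... | N , ht = M ℕ.⊔ N , λ n M⊔N≤n → begin-strict
    ∣ s n * t n ∣       ≡⟨ ∣p*q∣≡∣p∣*∣q∣ (s n) (t n) ⟩
    ∣ s n ∣ * ∣ t n ∣   ≤⟨ *-monoˡ-≤-nonNeg ∣ s n ∣ {{∣-∣-nonNeg (s n)}} (<⇒≤ (ht n (m⊔n≤o⇒n≤o M N M⊔N≤n))) ⟩
    ∣ s n ∣ * δ         <⟨ *-monoˡ-<-pos δ {{positive 0<δ}} (hs n (m⊔n≤o⇒m≤o M N M⊔N≤n)) ⟩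
    B * δ               ≡⟨ Bδ≡ε ⟩
    ε                   ∎
    where open ≤-Reasoning

  seq-bounded : ∀ x → Bounded (seq x)
  seq-bounded (mkℝ s cs) with cs 1ℚ (positive⁻¹ 1ℚ)
  ... | N , h = 1ℚ + ∣ s N ∣ , +-mono-<-≤ (positive⁻¹ 1ℚ) (0≤∣p∣ (s N)) , N , λ n N≤n → begin-strict
    ∣ s n ∣                   ≡⟨ cong ∣_∣ (solve 2 (λ a b → a := (a :- b) :+ b) refl (s n) (s N)) ⟩
    ∣ (s n - s N) + s N ∣     ≤⟨ ∣p+q∣≤∣p∣+∣q∣ (s n - s N) (s N) ⟩
    ∣ s n - s N ∣ + ∣ s N ∣   <⟨ +-monoˡ-< ∣ s N ∣ (h n N N≤n ≤ℕ-refl) ⟩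
    1ℚ + ∣ s N ∣              ∎
    where open ≤-Reasoning

  ≡⇒≃ᴿ : ∀ {x y} → (∀ n → seq x n ≡ seq y n) → x ≃ᴿ y
  ≡⇒≃ᴿ {x} {y} x≡y = mk≃ᴿ (null-cong
    (λ n → trans (sym (+-inverseʳ (seq x n))) (cong (λ q → seq x n - q) (x≡y n))) null-0)

  ≃ᴿ-sym : ∀ {x y} → x ≃ᴿ y → y ≃ᴿ x
  ≃ᴿ-sym {x} {y} (mk≃ᴿ d) = mk≃ᴿ (null-cong
    (λ n → solve 2 (λ a b → :- (a :- b) := b :- a) refl (seq x n) (seq y n)) (null-neg d))

  ≃ᴿ-trans : ∀ {x y z} → x ≃ᴿ y → y ≃ᴿ z → x ≃ᴿ z
  ≃ᴿ-trans {x} {y} {z} (mk≃ᴿ d) (mk≃ᴿ e) = mk≃ᴿ (null-cong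
    (λ n → solve 3 (λ a b c → (a :- b) :+ (b :- c) := a :- c) refl (seq x n) (seq y n) (seq z n))
    (null-+ d e))

  +ᴿ-cong : ∀ {x x′ y y′} → x ≃ᴿ x′ → y ≃ᴿ y′ → x +ᴿ y ≃ᴿ x′ +ᴿ y′
  +ᴿ-cong {x} {x′} {y} {y′} (mk≃ᴿ d) (mk≃ᴿ e) = mk≃ᴿ (null-cong
    (λ n → solve 4 (λ a a′ b b′ → (a :- a′) :+ (b :- b′) := (a :+ b) :- (a′ :+ b′)) refl
      (seq x n) (seq x′ n) (seq y n) (seq y′ n))
    (null-+ d e))

  -ᴿ-cong : ∀ {x x′} → x ≃ᴿ x′ → -ᴿ x ≃ᴿ -ᴿ x′
  -ᴿ-cong {x} {x′} (mk≃ᴿ d) = mk≃ᴿ (null-cong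
    (λ n → solve 2 (λ a a′ → :- (a :- a′) := :- a :- :- a′) refl (seq x n) (seq x′ n)) (null-neg d))

  *ᴿ-cong : ∀ {x x′ y y′} → x ≃ᴿ x′ → y ≃ᴿ y′ → x *ᴿ y ≃ᴿ x′ *ᴿ y′
  *ᴿ-cong {x} {x′} {y} {y′} (mk≃ᴿ d) (mk≃ᴿ e) = mk≃ᴿ (null-cong
    (λ n → solve 4 (λ a a′ b b′ → a :* (b :- b′) :+ b′ :* (a :- a′) := a :* b :- a′ :* b′) refl
      (seq x n) (seq x′ n) (seq y n) (seq y′ n))
    (null-+ {λ n → seq x n * (seq y n - seq y′ n)} {λ n → seq y′ n * (seq x n - seq x′ n)}
      (null-* {seq x} (seq-bounded x) e) (null-* {seq y′} (seq-bounded y′) d)))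

-- The commutative ring of complex numbers

module ComplexRing where

  open import Data.Integer.Base using (+_)
  open import Data.Product.Base using (_,_)
  open import Data.Rational.Base
  open import Data.Rational.Properties using (+-assoc; +-comm; +-identityˡ; +-identityʳ; +-inverseˡ; +-inverseʳ)
  open import Data.Rational.Solver using (module +-*-Solver)
  open import Level using (0ℓ)
  open import Relation.Binary.PropositionalEquality using (_≡_; refl)
  open +-*-Solver using (solve; _:=_; _:+_; _:*_; _:-_; :-_; con)
  open NullSequences

  -- The operations act index by index, so every ring law reduces to an identity of rationals;
  -- estimates enter only through the congruences.
  termwise : ∀ {z w} → (∀ n → seq (re z) n ≡ seq (re w) n) → (∀ n → seq (im z) n ≡ seq (im w) n) → z ≃ᶜ w
  termwise r i = mk≃ᶜ (≡⇒≃ᴿ r) (≡⇒≃ᴿ i)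

  -ᶜ_ : ℂ → ℂ
  -ᶜ z = (-ᴿ re z) +i (-ᴿ im z)

  ℂ-commutativeRing : CommutativeRing 0ℓ 0ℓ
  ℂ-commutativeRing = record
    { Carrier = ℂ
    ; _≈_ = _≃ᶜ_
    ; _+_ = _+ᶜ_
    ; _*_ = _*ᶜ_
    ; -_  = -ᶜ_
    ; 0#  = intᶜ (+ 0)
    ; 1#  = intᶜ (+ 1)
    ; isCommutativeRing = record
      { isRing = record
        { +-isAbelianGroup = record
          { isGroup = record
            { isMonoid = record
              { isSemigroup = record
                { isMagma = record
                  { isEquivalence = record
                    { refl  = termwise (λ _ → refl) (λ _ → refl)
                    ; sym   = λ (mk≃ᶜ r i) → mk≃ᶜ (≃ᴿ-sym r) (≃ᴿ-sym i)
                    ; trans = λ (mk≃ᶜ r i) (mk≃ᶜ r′ i′) → mk≃ᶜ (≃ᴿ-trans r r′) (≃ᴿ-trans i i′)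
                    }
                  ; ∙-cong = λ (mk≃ᶜ r i) (mk≃ᶜ r′ i′) → mk≃ᶜ (+ᴿ-cong r r′) (+ᴿ-cong i i′)
                  }
                ; assoc = λ x y z → termwise
                    (λ n → +-assoc (seq (re x) n) (seq (re y) n) (seq (re z) n))
                    (λ n → +-assoc (seq (im x) n) (seq (im y) n) (seq (im z) n))
                }
              ; identity =
                  (λ x → termwise (λ n → +-identityˡ (seq (re x) n)) (λ n → +-identityˡ (seq (im x) n))) ,
                  (λ x → termwise (λ n → +-identityʳ (seq (re x) n)) (λ n → +-identityʳ (seq (im x) n)))
              }
            ; inverse =
                (λ x → termwise (λ n → +-inverseˡ (seq (re x) n)) (λ n → +-inverseˡ (seq (im x) n))) ,
                (λ x → termwise (λ n → +-inverseʳ (seq (re x) n)) (λ n → +-inverseʳ (seq (im x) n)))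
            ; ⁻¹-cong = λ (mk≃ᶜ r i) → mk≃ᶜ (-ᴿ-cong r) (-ᴿ-cong i)
            }
          ; comm = λ x y → termwise
              (λ n → +-comm (seq (re x) n) (seq (re y) n)) (λ n → +-comm (seq (im x) n) (seq (im y) n))
          }
        ; *-cong = λ (mk≃ᶜ r i) (mk≃ᶜ r′ i′) → mk≃ᶜ
            (+ᴿ-cong (*ᴿ-cong r r′) (-ᴿ-cong (*ᴿ-cong i i′)))
            (+ᴿ-cong (*ᴿ-cong r i′) (*ᴿ-cong i r′))
        ; *-assoc = λ x y z → termwise
            (λ n → solve 6 (λ a b c d e f →
                (a :* c :- b :* d) :* e :- (a :* d :+ b :* c) :* f :=
                a :* (c :* e :- d :* f) :- b :* (c :* f :+ d :* e)) refl
              (seq (re x) n) (seq (im x) n) (seq (re y) n) (seq (im y) n) (seq (re z) n) (seq (im z) n))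
            (λ n → solve 6 (λ a b c d e f →
                (a :* c :- b :* d) :* f :+ (a :* d :+ b :* c) :* e :=
                a :* (c :* f :+ d :* e) :+ b :* (c :* e :- d :* f)) refl
              (seq (re x) n) (seq (im x) n) (seq (re y) n) (seq (im y) n) (seq (re z) n) (seq (im z) n))
        ; *-identity =
            (λ x → termwise
              (λ n → solve 2 (λ a b → con 1ℚ :* a :- con 0ℚ :* b := a) refl (seq (re x) n) (seq (im x) n))
              (λ n → solve 2 (λ a b → con 1ℚ :* b :+ con 0ℚ :* a := b) refl (seq (re x) n) (seq (im x) n))) ,
            (λ x → termwise
              (λ n → solve 2 (λ a b → a :* con 1ℚ :- b :* con 0ℚ := a) refl (seq (re x) n) (seq (im x) n))
              (λ n → solve 2 (λ a b → a :* con 0ℚ :+ b :* con 1ℚ := b) refl (seq (re x) n) (seq (im x) n)))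
        ; distrib =
            (λ x y z → termwise
              (λ n → solve 6 (λ a b c d e f →
                  a :* (c :+ e) :- b :* (d :+ f) := (a :* c :- b :* d) :+ (a :* e :- b :* f)) refl
                (seq (re x) n) (seq (im x) n) (seq (re y) n) (seq (im y) n) (seq (re z) n) (seq (im z) n))
              (λ n → solve 6 (λ a b c d e f →
                  a :* (d :+ f) :+ b :* (c :+ e) := (a :* d :+ b :* c) :+ (a :* f :+ b :* e)) refl
                (seq (re x) n) (seq (im x) n) (seq (re y) n) (seq (im y) n) (seq (re z) n) (seq (im z) n))) ,
            (λ x y z → termwise
              (λ n → solve 6 (λ a b c d e f →
                  (c :+ e) :* a :- (d :+ f) :* b := (c :* a :- d :* b) :+ (e :* a :- f :* b)) refl
                (seq (re x) n) (seq (im x) n) (seq (re y) n) (seq (im y) n) (seq (re z) n) (seq (im z) n))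
              (λ n → solve 6 (λ a b c d e f →
                  (c :+ e) :* b :+ (d :+ f) :* a := (c :* b :+ d :* a) :+ (e :* b :+ f :* a)) refl
                (seq (re x) n) (seq (im x) n) (seq (re y) n) (seq (im y) n) (seq (re z) n) (seq (im z) n)))
        }
      ; *-comm = λ x y → termwise
          (λ n → solve 4 (λ a b c d → a :* c :- b :* d := c :* a :- d :* b) refl
            (seq (re x) n) (seq (im x) n) (seq (re y) n) (seq (im y) n))
          (λ n → solve 4 (λ a b c d → a :* d :+ b :* c := c :* b :+ d :* a) refl
            (seq (re x) n) (seq (im x) n) (seq (re y) n) (seq (im y) n))
      }
    }

-- The embedding of the integers in the rationals

module IntegerCasts where

  open import Data.Integer.Base as ℤ using (ℤ; +_; -[1+_]; +0; +[1+_])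
  import Data.Integer.Properties as ℤ
  open import Data.Nat.Base as ℕ using (ℕ; suc; s≤s; z≤n)
  open import Data.Nat.Coprimality using (1-coprimeTo) renaming (sym to coprime-sym)
  import Data.Nat.Properties as ℕ
  open import Data.Product.Base using (∃; _,_)
  open import Data.Rational.Base
  open import Data.Rational.Properties
  open import Data.Rational.Unnormalised.Base as ℚᵘ using (mkℚᵘ)
  import Data.Rational.Unnormalised.Properties as ℚᵘ
  open import Relation.Binary.PropositionalEquality

  private
    -- `i / 1` is normalised by a gcd and is stuck on a variable `i`. This is the same number as an
    -- explicit reduced fraction, on which the rational operations unfold.
    cast : ℤ → ℚ
    cast i = mkℚ i 0 (coprime-sym (1-coprimeTo ℤ.∣ i ∣))

    /1≡cast : ∀ i → i / 1 ≡ cast i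
    /1≡cast i = fromℚᵘ-toℚᵘ (cast i)

  /1-+ : ∀ i j → (i ℤ.+ j) / 1 ≡ i / 1 + j / 1
  /1-+ i j = begin
    (i ℤ.+ j) / 1   ≡⟨ /-cong (sym (cong₂ ℤ._+_ (ℤ.*-identityʳ i) (ℤ.*-identityʳ j))) refl ⟩
    cast i + cast j ≡⟨ cong₂ _+_ (/1≡cast i) (/1≡cast j) ⟨
    i / 1 + j / 1   ∎
    where open ≡-Reasoning

  /1-* : ∀ i j → (i ℤ.* j) / 1 ≡ (i / 1) * (j / 1)
  /1-* i j = sym (cong₂ _*_ (/1≡cast i) (/1≡cast j))

  /1-neg : ∀ i → (ℤ.- i) / 1 ≡ - (i / 1)
  /1-neg +0       = refl
  /1-neg +[1+ n ] = refl
  /1-neg -[1+ n ] = sym (⁻¹-involutive (+[1+ n ] / 1))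
    where open import Algebra.Properties.Group +-0-group using (⁻¹-involutive)

  /1-mono-≤ : ∀ i j → i ℤ.≤ j → i / 1 ≤ j / 1
  /1-mono-≤ i j i≤j rewrite /1≡cast i | /1≡cast j =
    *≤* (subst₂ ℤ._≤_ (sym (ℤ.*-identityʳ i)) (sym (ℤ.*-identityʳ j)) i≤j)

  /1-mono-< : ∀ i j → i ℤ.< j → i / 1 < j / 1
  /1-mono-< i j i<j rewrite /1≡cast i | /1≡cast j =
    *<* (subst₂ ℤ._<_ (sym (ℤ.*-identityʳ i)) (sym (ℤ.*-identityʳ j)) i<j)

  ℕ/1-suc : ∀ n → + suc n / 1 ≡ + n / 1 + 1ℚ
  ℕ/1-suc n = trans (cong (λ i → i / 1) (trans (cong +_ (ℕ.+-comm 1 n)) (ℤ.pos-+ n 1))) (/1-+ (+ n) (+ 1))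

  0≤ℕ/1 : ∀ n → 0ℚ ≤ + n / 1
  0≤ℕ/1 n = /1-mono-≤ (+ 0) (+ n) (ℤ.+≤+ z≤n)

  0<ℕ/1 : ∀ n → 0ℚ < + suc n / 1
  0<ℕ/1 n = /1-mono-< (+ 0) (+ suc n) (ℤ.+<+ (s≤s z≤n))

  /1-*-reciprocal : ∀ n .{{_ : ℕ.NonZero n}} → (+ n / 1) * (+ 1 / n) ≡ 1ℚ
  /1-*-reciprocal n@(suc m) = toℚᵘ-injective (begin
    toℚᵘ ((+ n / 1) * (+ 1 / n))       ≈⟨ toℚᵘ-homo-* (+ n / 1) (+ 1 / n) ⟩
    toℚᵘ (+ n / 1) ℚᵘ.* toℚᵘ (+ 1 / n) ≈⟨ ℚᵘ.*-cong (toℚᵘ-fromℚᵘ (mkℚᵘ (+ n) 0)) (toℚᵘ-fromℚᵘ (mkℚᵘ (+ 1) m)) ⟩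
    mkℚᵘ (+ n) 0 ℚᵘ.* mkℚᵘ (+ 1) m     ≈⟨ ℚᵘ.*≡* (trans (ℤ.*-identityʳ _) (trans (ℤ.*-identityʳ _)
                                            (sym (trans (ℤ.*-identityˡ _) (cong +_ (ℕ.*-identityˡ n)))))) ⟩
    toℚᵘ 1ℚ                            ∎)
    where open import Relation.Binary.Reasoning.Setoid ℚᵘ.≃-setoid

  -- A positive `ε` has the form `(p + 1) / (q + 1)`; multiplying by its denominator leaves
  -- `p + 1 ≥ 1`.
  archimedean : ∀ {ε} → 0ℚ < ε → ∃ λ n → 1ℚ ≤ (+ suc n / 1) * ε
  archimedean {ε} 0<ε with positive 0<ε
  archimedean {ε@(mkℚ +[1+ p ] q _)} _ | _ = q , subst (λ r → 1ℚ ≤ r * ε) (sym (/1≡cast (+ suc q)))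
    (toℚᵘ-cancel-≤ (ℚᵘ.≤-respʳ-≃ (ℚᵘ.≃-sym (toℚᵘ-homo-* (cast (+ suc q)) ε))
      (ℚᵘ.*≤* (subst₂ ℤ._≤_
        (sym (trans (ℤ.*-identityˡ _) (cong +_ (ℕ.*-identityˡ (suc q)))))
        (trans (ℤ.pos-* (suc q) (suc p)) (sym (ℤ.*-identityʳ _)))
        (ℤ.+≤+ (ℕ.m≤m*n (suc q) (suc p)))))))

-- Rational inequalities and absolute values

module LinearInequalities where

  open import Data.Rational.Base
  open import Data.Rational.Properties
  open import Data.Rational.Solver using (module +-*-Solver)
  open import Data.Sum.Base using (inj₁; inj₂)
  open import Relation.Binary.PropositionalEquality using (_≡_; refl; sym; subst; subst₂)
  open +-*-Solver using (solve; _:=_; _:+_; _:-_; :-_; con)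

  0≤- : ∀ {p q} → p ≤ q → 0ℚ ≤ q - p
  0≤- {p} {q} p≤q = subst (_≤ q - p) (+-inverseʳ p) (+-monoˡ-≤ (- p) p≤q)

  0<- : ∀ {p q} → p < q → 0ℚ < q - p
  0<- {p} {q} p<q = subst (_< q - p) (+-inverseʳ p) (+-monoˡ-< (- p) p<q)

  -- Opens inequalities to the ring solver: `r` is a rewriting of `q - p` whose sign is evident.
  -≥0 : ∀ {p q r} → q - p ≡ r → 0ℚ ≤ r → p ≤ q
  -≥0 {p} {q} {r} q-p≡r 0≤r = subst₂ _≤_ (+-identityˡ p)
    (solve 2 (λ p q → (q :- p) :+ p := q) refl p q)
    (+-monoˡ-≤ p (subst (0ℚ ≤_) (sym q-p≡r) 0≤r))

  ->0 : ∀ {p q r} → q - p ≡ r → 0ℚ < r → p < q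
  ->0 {p} {q} {r} q-p≡r 0<r = subst₂ _<_ (+-identityˡ p)
    (solve 2 (λ p q → (q :- p) :+ p := q) refl p q)
    (+-monoˡ-< p (subst (0ℚ <_) (sym q-p≡r) 0<r))

  0≤+ : ∀ {p q} → 0ℚ ≤ p → 0ℚ ≤ q → 0ℚ ≤ p + q
  0≤+ = +-mono-≤

  0<+ : ∀ {p q} → 0ℚ < p → 0ℚ ≤ q → 0ℚ < p + q
  0<+ = +-mono-<-≤

  0≤* : ∀ {p q} → 0ℚ ≤ p → 0ℚ ≤ q → 0ℚ ≤ p * q
  0≤* {p} {q} 0≤p 0≤q = nonNegative⁻¹ (p * q) {{nonNeg*nonNeg⇒nonNeg p {{nonNegative 0≤p}} q {{nonNegative 0≤q}}}}

  p≤∣p∣ : ∀ p → p ≤ ∣ p ∣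
  p≤∣p∣ p with ≤-total 0ℚ p
  ... | inj₁ 0≤p = ≤-reflexive (sym (0≤p⇒∣p∣≡p 0≤p))
  ... | inj₂ p≤0 = ≤-trans p≤0 (0≤∣p∣ p)

  -p≤∣p∣ : ∀ p → - p ≤ ∣ p ∣
  -p≤∣p∣ p = subst (- p ≤_) (∣-p∣≡∣p∣ p) (p≤∣p∣ (- p))

  ∣p∣≤ : ∀ {p q} → p ≤ q → - p ≤ q → ∣ p ∣ ≤ q
  ∣p∣≤ {p} {q} p≤q -p≤q with ∣p∣≡p∨∣p∣≡-p p
  ... | inj₁ eq = subst (_≤ q) (sym eq) p≤q
  ... | inj₂ eq = subst (_≤ q) (sym eq) -p≤q

  ∣p∣< : ∀ {p q} → p < q → - p < q → ∣ p ∣ < q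
  ∣p∣< {p} {q} p<q -p<q with ∣p∣≡p∨∣p∣≡-p p
  ... | inj₁ eq = subst (_< q) (sym eq) p<q
  ... | inj₂ eq = subst (_< q) (sym eq) -p<q

  close-in-interval : ∀ {l w x y} → l ≤ x → x ≤ l + w → l ≤ y → y ≤ l + w → ∣ x - y ∣ ≤ w
  close-in-interval {l} {w} {x} {y} l≤x x≤l+w l≤y y≤l+w = ∣p∣≤ (one-sided l≤y x≤l+w)
    (subst (_≤ w) (solve 2 (λ x y → y :- x := :- (x :- y)) refl x y) (one-sided l≤x y≤l+w))
    where
    one-sided : ∀ {x y} → l ≤ y → x ≤ l + w → x - y ≤ w
    one-sided {x} {y} l≤y x≤l+w = -≥0
      (solve 4 (λ l w x y → w :- (x :- y) := ((l :+ w) :- x) :+ (y :- l)) refl l w x y)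
      (0≤+ (0≤- x≤l+w) (0≤- l≤y))

-- Bisection for a Lipschitz function on a unit interval

module Bisection where

  open import Data.Integer.Base using (+_)
  open import Data.Nat.Base as ℕ using (ℕ; zero; suc)
  open import Data.Nat.Properties using (≤⇒≤′) renaming (≤-refl to ≤ℕ-refl)
  open import Data.Product.Base using (∃; _,_)
  open import Data.Rational.Base
  open import Data.Rational.Properties
  open import Data.Rational.Solver using (module +-*-Solver)
  open import Relation.Binary.PropositionalEquality using (_≡_; refl; sym; trans; cong; subst)
  open import Relation.Nullary.Decidable using (yes; no)
  open +-*-Solver using (solve; _:=_; _:+_; _:*_; _:-_; :-_; con)
  open NullSequences
  open IntegerCasts
  open LinearInequalities

  half^ : ℕ → ℚ
  half^ zero    = 1ℚ
  half^ (suc n) = ½ * half^ n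

  0<half^ : ∀ n → 0ℚ < half^ n
  0<half^ zero    = positive⁻¹ 1ℚ
  0<half^ (suc n) = 0<* (positive⁻¹ ½) (0<half^ n)

  half^-antitone : ∀ {m n} → m ℕ.≤ n → half^ n ≤ half^ m
  half^-antitone m≤n = go (≤⇒≤′ m≤n)
    where
    go : ∀ {m n} → m ℕ.≤′ n → half^ n ≤ half^ m
    go ℕ.≤′-refl                 = ≤-refl
    go {m} (ℕ.≤′-step {n} m≤′n) = ≤-trans
      (-≥0 (solve 1 (λ h → h :- con ½ :* h := con ½ :* h) refl (half^ n)) (<⇒≤ (0<half^ (suc n))))
      (go m≤′n)

  -- The Bernoulli bound `n + 1 ≤ 2ⁿ`: passing from `n` to `n + 1` lowers the left side by
  -- `½ · half^ n · n`.
  half^-bound : ∀ n → half^ n * (+ suc n / 1) ≤ 1ℚ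
  half^-bound zero    = ≤-refl
  half^-bound (suc n) = ≤-trans
    (-≥0 (trans
      (cong (λ k → half^ n * (+ suc n / 1) - half^ (suc n) * k) (ℕ/1-suc (suc n)))
      (trans
        (cong (λ k → half^ n * k - half^ (suc n) * (k + 1ℚ)) (ℕ/1-suc n))
        (solve 2 (λ h k → h :* (k :+ con 1ℚ) :- con ½ :* h :* ((k :+ con 1ℚ) :+ con 1ℚ) := con ½ :* h :* k)
          refl (half^ n) (+ n / 1))))
      (0≤* (<⇒≤ (0<half^ (suc n))) (0≤ℕ/1 n)))
    (half^-bound n)

  half^-null : ∀ ε → 0ℚ < ε → ∃ λ N → ∀ n → N ℕ.≤ n → half^ n < ε
  half^-null ε 0<ε with archimedean 0<ε
  ... | k , 1≤kε = suc k , λ n N≤n → ≤-<-trans (half^-antitone N≤n)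
    -- With exponent `k + 1`: `half^ (k + 1) · (k + 2) ≤ 1 ≤ (k + 1) ε < (k + 2) ε`.
    (*-cancelʳ-<-nonNeg (+ suc (suc k) / 1) {{nonNegative (0≤ℕ/1 (suc (suc k)))}} (≤-<-trans (half^-bound (suc k))
      (≤-<-trans 1≤kε (->0 (trans
        (cong (λ c → ε * c - (+ suc k / 1) * ε) (ℕ/1-suc (suc k)))
        (solve 2 (λ ε c → ε :* (c :+ con 1ℚ) :- c :* ε := ε) refl ε (+ suc k / 1))) 0<ε))))

  LipschitzOn : ℚ → ℚ → ℚ → (ℚ → ℚ) → Set
  LipschitzOn K a b h = ∀ x y → a ≤ x → x ≤ b → a ≤ y → y ≤ b → ∣ h x - h y ∣ ≤ K * ∣ x - y ∣

  module _ (h : ℚ → ℚ) (a K : ℚ) (0<K : 0ℚ < K) (lip : LipschitzOn K a (a + 1ℚ) h)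
           (ha<0 : h a < 0ℚ) (0<hb : 0ℚ < h (a + 1ℚ)) where

    -- Only the left endpoint is recorded, the width after `n` halvings being `half^ n`. The branch
    -- is decidable because the midpoint and its value are rational. A zero value moves the left
    -- endpoint, so the sign invariants are weak inequalities.
    left : ℕ → ℚ
    left zero    = a
    left (suc n) with h (left n + half^ (suc n)) ≤? 0ℚ
    ... | yes _ = left n + half^ (suc n)
    ... | no  _ = left n

    right : ℕ → ℚ
    right n = left n + half^ n

    private
      right-half : ∀ n → (left n + half^ (suc n)) + half^ (suc n) ≡ right n
      right-half n = solve 2 (λ l h → (l :+ con ½ :* h) :+ con ½ :* h := l :+ h) refl (left n) (half^ n)

    left-step : ∀ n → left n ≤ left (suc n)
    left-step n with h (left n + half^ (suc n)) ≤? 0ℚ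
    ... | yes _ = -≥0 (solve 2 (λ l h → (l :+ h) :- l := h) refl (left n) (half^ (suc n))) (<⇒≤ (0<half^ (suc n)))
    ... | no  _ = ≤-refl

    right-step : ∀ n → right (suc n) ≤ right n
    right-step n with h (left n + half^ (suc n)) ≤? 0ℚ
    ... | yes _ = ≤-reflexive (right-half n)
    ... | no  _ = -≥0 (solve 2 (λ l h → (l :+ h) :- (l :+ con ½ :* h) := con ½ :* h) refl (left n) (half^ n))
                    (<⇒≤ (0<half^ (suc n)))

    left-sign : ∀ n → h (left n) ≤ 0ℚ
    left-sign zero    = <⇒≤ ha<0
    left-sign (suc n) with h (left n + half^ (suc n)) ≤? 0ℚ
    ... | yes h≤0 = h≤0
    ... | no  _   = left-sign n

    right-sign : ∀ n → 0ℚ ≤ h (right n)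
    right-sign zero    = <⇒≤ 0<hb
    right-sign (suc n) with h (left n + half^ (suc n)) ≤? 0ℚ
    ... | yes _   = subst (λ x → 0ℚ ≤ h x) (sym (right-half n)) (right-sign n)
    ... | no  h≰0 = <⇒≤ (≰⇒> h≰0)

    left-mono : ∀ {m n} → m ℕ.≤ n → left m ≤ left n
    left-mono m≤n = go (≤⇒≤′ m≤n)
      where
      go : ∀ {m n} → m ℕ.≤′ n → left m ≤ left n
      go ℕ.≤′-refl            = ≤-refl
      go (ℕ.≤′-step {n} m≤′n) = ≤-trans (go m≤′n) (left-step n)

    right-anti : ∀ {m n} → m ℕ.≤ n → right n ≤ right m
    right-anti m≤n = go (≤⇒≤′ m≤n)
      where
      go : ∀ {m n} → m ℕ.≤′ n → right n ≤ right m
      go ℕ.≤′-refl            = ≤-refl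
      go (ℕ.≤′-step {n} m≤′n) = ≤-trans (right-step n) (go m≤′n)

    left≤right : ∀ n → left n ≤ right n
    left≤right n = -≥0 (solve 2 (λ l h → (l :+ h) :- l := h) refl (left n) (half^ n)) (<⇒≤ (0<half^ n))

    a≤left : ∀ n → a ≤ left n
    a≤left n = left-mono {0} {n} ℕ.z≤n

    right≤b : ∀ n → right n ≤ a + 1ℚ
    right≤b n = right-anti {0} {n} ℕ.z≤n

    left≤b : ∀ n → left n ≤ a + 1ℚ
    left≤b n = ≤-trans (left≤right n) (right≤b n)

    a≤right : ∀ n → a ≤ right n
    a≤right n = ≤-trans (a≤left n) (left≤right n)

    slope : ∀ x y → y ≤ x → a ≤ y → x ≤ a + 1ℚ → h x - h y ≤ K * (x - y)
    slope x y y≤x a≤y x≤b = ≤-trans (p≤∣p∣ (h x - h y))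
      (subst (λ d → ∣ h x - h y ∣ ≤ K * d) (0≤p⇒∣p∣≡p (0≤- y≤x))
        (lip x y (≤-trans a≤y y≤x) x≤b a≤y (≤-trans y≤x x≤b)))

    left≤right′ : ∀ {m n} → m ℕ.≤ n → left n ≤ right m
    left≤right′ {n = n} m≤n = ≤-trans (left≤right n) (right-anti m≤n)

    -- From index `N` on, all left endpoints stay inside the `N`-th interval, whose width is
    -- `half^ N`.
    left-cauchy : Cauchy left
    left-cauchy ε 0<ε = let N , w<ε = half^-null ε 0<ε in N , λ m n N≤m N≤n → ≤-<-trans
      (close-in-interval (left-mono N≤m) (left≤right′ N≤m) (left-mono N≤n) (left≤right′ N≤n))
      (w<ε N ≤ℕ-refl)

    root : ℝ
    root = mkℝ left left-cauchy

    -- Squeezed by the sign change: `0 ≤ - h (left n) ≤ h (right n) - h (left n) ≤ K * half^ n`.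
    root-null : Null (λ n → h (left n))
    root-null ε 0<ε =
      let δ , 0<δ , Kδ≡ε = quotient 0<K 0<ε
          N , w<δ        = half^-null δ 0<δ
      in N , λ n N≤n → ∣p∣< (≤-<-trans (left-sign n) 0<ε) (begin-strict
        - h (left n)                ≤⟨ -≥0 (solve 2 (λ r l → (r :- l) :- :- l := r) refl (h (right n)) (h (left n))) (right-sign n) ⟩
        h (right n) - h (left n)    ≤⟨ slope (right n) (left n) (left≤right n) (a≤left n) (right≤b n) ⟩
        K * (right n - left n)      ≡⟨ cong (K *_) (solve 2 (λ l w → (l :+ w) :- l := w) refl (left n) (half^ n)) ⟩
        K * half^ n                 <⟨ *-monoʳ-<-pos K {{positive 0<K}} (w<δ n N≤n) ⟩
        K * δ                       ≡⟨ Kδ≡ε ⟩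
        ε                           ∎)
      where open ≤-Reasoning

    -- The gap is `h (a + 1ℚ) / K`: starting from a value `≤ 0`, a function with Lipschitz constant
    -- `K` needs at least that distance to reach `h (a + 1ℚ)`.
    root<b : root <ᴿ fromℚ (a + 1ℚ)
    root<b =
      let δ , 0<δ , Kδ≡hb = quotient 0<K 0<hb
      in mk<ᴿ δ 0<δ 0 λ n _ → -≥0
        (solve 3 (λ b l δ → b :- (l :+ δ) := (b :- l) :- δ) refl (a + 1ℚ) (left n) δ)
        (0≤- (*-cancelˡ-≤-pos K {{positive 0<K}} (begin
          K * δ                      ≡⟨ Kδ≡hb ⟩
          h (a + 1ℚ)                 ≤⟨ -≥0 (solve 2 (λ r l → (r :- l) :- r := :- l) refl (h (a + 1ℚ)) (h (left n)))
                                          (neg-antimono-≤ (left-sign n)) ⟩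
          h (a + 1ℚ) - h (left n)    ≤⟨ slope (a + 1ℚ) (left n) (left≤b n) (a≤left n) ≤-refl ⟩
          K * ((a + 1ℚ) - left n)    ∎)))
      where open ≤-Reasoning

    -- The Lipschitz bound keeps the right endpoints at distance at least `δ = - h a / K` from `a`.
    -- The left ones trail by `half^ n`, so half of `δ` remains once `half^ n < ½ * δ`.
    a<root : fromℚ a <ᴿ root
    a<root =
      let δ , 0<δ , Kδ≡-ha = quotient 0<K (neg-antimono-< ha<0)
          N , w<δ          = half^-null (½ * δ) (0<* (positive⁻¹ ½) 0<δ)
      in mk<ᴿ (½ * δ) (0<* (positive⁻¹ ½) 0<δ) N λ n N≤n → -≥0
        (solve 4 (λ l a w δ → l :- (a :+ con ½ :* δ) := (((l :+ w) :- a) :- δ) :+ (con ½ :* δ :- w)) refl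
          (left n) a (half^ n) δ)
        (0≤+ (0≤- (*-cancelˡ-≤-pos K {{positive 0<K}} (begin
          K * δ               ≡⟨ Kδ≡-ha ⟩
          - h a               ≤⟨ -≥0 (solve 2 (λ r l → (r :- l) :- :- l := r) refl (h (right n)) (h a)) (right-sign n) ⟩
          h (right n) - h a   ≤⟨ slope (right n) a (a≤right n) ≤-refl (right≤b n) ⟩
          K * (right n - a)   ∎))) (0≤- (<⇒≤ (w<δ n N≤n))))
      where open ≤-Reasoning

-- Cancellable complex numbers and separation of real points

module ComplexSeparation where

  open import Data.Integer.Base using (+_)
  open import Data.Nat.Base as ℕ using (ℕ)
  open import Data.Nat.Properties using (m⊔n≤o⇒m≤o; m⊔n≤o⇒n≤o)
    renaming (≤-refl to ≤ℕ-refl)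
  open import Data.Product.Base using (_,_; proj₁; proj₂)
  open import Data.Rational.Base
  open import Data.Rational.Properties
  open import Data.Rational.Solver using (module +-*-Solver)
  open import Data.Sum.Base using (_⊎_; inj₁; inj₂; swap)
  open import Relation.Binary.PropositionalEquality using (_≡_; refl; trans; cong₂; subst)
  open import Relation.Nullary.Negation using (¬_)
  open +-*-Solver using (solve; _:=_; _:+_; _:*_; _:-_; :-_; con)
  open NullSequences
  open LinearInequalities
  open ComplexRing
  open PolynomialFunctions ℂ-commutativeRing public

  null-cancel : ∀ κ N (s : ℕ → ℚ) {t} → 0ℚ < κ → (∀ n → N ℕ.≤ n → κ ≤ s n) → Null (λ n → s n * t n) → Null t
  null-cancel κ N s {t} 0<κ κ≤s nst ε 0<ε =
    let M , st< = nst (κ * ε) (0<* 0<κ 0<ε)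
    in N ℕ.⊔ M , λ n N⊔M≤n → *-cancelˡ-<-nonNeg κ {{nonNegative (<⇒≤ 0<κ)}} (begin-strict
      κ * ∣ t n ∣         ≤⟨ *-monoʳ-≤-nonNeg ∣ t n ∣ {{∣-∣-nonNeg (t n)}}
                               (≤-trans (κ≤s n (m⊔n≤o⇒m≤o N M N⊔M≤n)) (p≤∣p∣ (s n))) ⟩
      ∣ s n ∣ * ∣ t n ∣   ≡⟨ ∣p*q∣≡∣p∣*∣q∣ (s n) (t n) ⟨
      ∣ s n * t n ∣       <⟨ st< n (m⊔n≤o⇒n≤o N M N⊔M≤n) ⟩
      κ * ε               ∎)
    where open ≤-Reasoning

  ∣p∣*∣p∣≡p*p : ∀ p → ∣ p ∣ * ∣ p ∣ ≡ p * p
  ∣p∣*∣p∣≡p*p p with ∣p∣≡p∨∣p∣≡-p p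
  ... | inj₁ eq = cong₂ _*_ eq eq
  ... | inj₂ eq = trans (cong₂ _*_ eq eq) (solve 1 (λ p → (:- p) :* (:- p) := p :* p) refl p)

  0≤p*p : ∀ p → 0ℚ ≤ p * p
  0≤p*p p = subst (0ℚ ≤_) (∣p∣*∣p∣≡p*p p) (0≤* (0≤∣p∣ p) (0≤∣p∣ p))

  -- Multiplication by the conjugate turns z into ∣z∣² ≥ δ².
  re-apart⇒cancellable : ∀ {z} δ N → 0ℚ < δ → (∀ n → N ℕ.≤ n → δ ≤ ∣ seq (re z) n ∣) → Cancellable z
  re-apart⇒cancellable {a +i b} δ N 0<δ δ≤∣a∣ w@(c +i d) zw≃0 =
    mk≃ᶜ
      (mk≃ᴿ (null-cancel (δ * δ) N ∣z∣² (0<* 0<δ 0<δ) δ²≤∣z∣² (null-cong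
        (λ n → solve 4 (λ a b c d →
            (a :* (a :* c :- b :* d) :- (:- b) :* (a :* d :+ b :* c)) :- (a :* con 0ℚ :- (:- b) :* con 0ℚ) :=
            (a :* a :+ b :* b) :* (c :- con 0ℚ)) refl (seq a n) (seq b n) (seq c n) (seq d n))
        (_≃ᴿ_.difference→0 (_≃ᶜ_.re-≃ conj)))))
      (mk≃ᴿ (null-cancel (δ * δ) N ∣z∣² (0<* 0<δ 0<δ) δ²≤∣z∣² (null-cong
        (λ n → solve 4 (λ a b c d →
            (a :* (a :* d :+ b :* c) :+ (:- b) :* (a :* c :- b :* d)) :- (a :* con 0ℚ :+ (:- b) :* con 0ℚ) :=
            (a :* a :+ b :* b) :* (d :- con 0ℚ)) refl (seq a n) (seq b n) (seq c n) (seq d n))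
        (_≃ᴿ_.difference→0 (_≃ᶜ_.im-≃ conj)))))
    where
    conj : (a +i -ᴿ b) *ᶜ ((a +i b) *ᶜ w) ≃ᶜ (a +i -ᴿ b) *ᶜ intᶜ (+ 0)
    conj = CommutativeRing.*-congˡ ℂ-commutativeRing {a +i -ᴿ b} zw≃0
    ∣z∣² : ℕ → ℚ
    ∣z∣² n = seq a n * seq a n + seq b n * seq b n
    δ²≤∣z∣² : ∀ n → N ℕ.≤ n → δ * δ ≤ ∣z∣² n
    δ²≤∣z∣² n N≤n = begin
      δ * δ                               ≤⟨ *-monoʳ-≤-nonNeg δ {{nonNegative (<⇒≤ 0<δ)}} (δ≤∣a∣ n N≤n) ⟩
      ∣ seq a n ∣ * δ                     ≤⟨ *-monoˡ-≤-nonNeg ∣ seq a n ∣ {{∣-∣-nonNeg (seq a n)}} (δ≤∣a∣ n N≤n) ⟩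
      ∣ seq a n ∣ * ∣ seq a n ∣           ≡⟨ ∣p∣*∣p∣≡p*p (seq a n) ⟩
      seq a n * seq a n                   ≡⟨ +-identityʳ (seq a n * seq a n) ⟨
      seq a n * seq a n + 0ℚ              ≤⟨ +-monoʳ-≤ (seq a n * seq a n) (0≤p*p (seq b n)) ⟩
      ∣z∣² n                              ∎
      where open ≤-Reasoning

  0-not-cancellable : ¬ Cancellable (intᶜ (+ 0))
  0-not-cancellable c =
    let mk≃ᶜ (mk≃ᴿ 1→0) _ = c (intᶜ (+ 1)) (CommutativeRing.zeroˡ ℂ-commutativeRing (intᶜ (+ 1)))
        N , 1<1 = 1→0 1ℚ (positive⁻¹ 1ℚ)
    in <-irrefl refl (1<1 N ≤ℕ-refl)

  private
    drift : ∀ δ a a′ b b′ → a + (δ + δ + δ + δ) ≤ b → ∣ a′ - a ∣ < δ → ∣ b′ - b ∣ < δ → δ + δ ≤ b′ - a′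
    drift δ a a′ b b′ a+4δ≤b a′-a<δ b′-b<δ = -≥0
      (solve 5 (λ δ a a′ b b′ → (b′ :- a′) :- (δ :+ δ) :=
          ((b :- (a :+ (δ :+ δ :+ δ :+ δ))) :+ (δ :- (a′ :- a))) :+ (δ :- :- (b′ :- b))) refl δ a a′ b b′)
      (0≤+ (0≤+ (0≤- a+4δ≤b) (0≤- (≤-trans (p≤∣p∣ (a′ - a)) (<⇒≤ a′-a<δ))))
           (0≤- (≤-trans (-p≤∣p∣ (b′ - b)) (<⇒≤ b′-b<δ))))

  -- Take `δ` to be an eighth of the gap and `M` an index from which each sequence stays within `δ`
  -- of its `M`-th term. The rational `Z M` is compared with `X M + 4δ`: it is at least `4δ` above
  -- `X M`, or at least `4δ` below `Y M`. Two drifts of less than `δ` each leave `2δ` at all later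
  -- indices.
  <ᴿ⇒Separated : ∀ {x y} → x <ᴿ y → Separated (real x) (real y)
  <ᴿ⇒Separated {x} {y} (mk<ᴿ γ 0<γ N₀ x+γ≤y) z = decide (≤-total (X M + 4δ) (Z M))
    where
    δ 4δ : ℚ
    δ = (½ * (½ * ½)) * γ
    4δ = δ + δ + δ + δ
    0<δ : 0ℚ < δ
    0<δ = 0<* (positive⁻¹ (½ * (½ * ½))) 0<γ
    0<2δ : 0ℚ < δ + δ
    0<2δ = 0<+ 0<δ (<⇒≤ 0<δ)
    X Y Z : ℕ → ℚ
    X = seq x
    Y = seq y
    Z = seq (re z)
    Nx Ny Nz M : ℕ
    Nx = proj₁ (cauchy x δ 0<δ)
    Ny = proj₁ (cauchy y δ 0<δ)
    Nz = proj₁ (cauchy (re z) δ 0<δ)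
    M = (Nx ℕ.⊔ Ny) ℕ.⊔ (Nz ℕ.⊔ N₀)
    xy≤ : ∀ {n} → M ℕ.≤ n → Nx ℕ.⊔ Ny ℕ.≤ n
    xy≤ = m⊔n≤o⇒m≤o (Nx ℕ.⊔ Ny) (Nz ℕ.⊔ N₀)
    z0≤ : ∀ {n} → M ℕ.≤ n → Nz ℕ.⊔ N₀ ℕ.≤ n
    z0≤ = m⊔n≤o⇒n≤o (Nx ℕ.⊔ Ny) (Nz ℕ.⊔ N₀)
    X-close : ∀ n → M ℕ.≤ n → ∣ X n - X M ∣ < δ
    X-close n M≤n = proj₂ (cauchy x δ 0<δ) n M (m⊔n≤o⇒m≤o Nx Ny (xy≤ M≤n)) (m⊔n≤o⇒m≤o Nx Ny (xy≤ ≤ℕ-refl))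
    Y-close : ∀ n → M ℕ.≤ n → ∣ Y n - Y M ∣ < δ
    Y-close n M≤n = proj₂ (cauchy y δ 0<δ) n M (m⊔n≤o⇒n≤o Nx Ny (xy≤ M≤n)) (m⊔n≤o⇒n≤o Nx Ny (xy≤ ≤ℕ-refl))
    Z-close : ∀ n → M ℕ.≤ n → ∣ Z n - Z M ∣ < δ
    Z-close n M≤n = proj₂ (cauchy (re z) δ 0<δ) n M (m⊔n≤o⇒m≤o Nz N₀ (z0≤ M≤n)) (m⊔n≤o⇒m≤o Nz N₀ (z0≤ ≤ℕ-refl))
    Z+4δ≤Y : Z M ≤ X M + 4δ → Z M + 4δ ≤ Y M
    Z+4δ≤Y Z≤ = -≥0
      (solve 4 (λ x y z γ → let δ = con (½ * (½ * ½)) :* γ ; 4δ = δ :+ δ :+ δ :+ δ in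
          y :- (z :+ 4δ) := (y :- (x :+ γ)) :+ ((x :+ 4δ) :- z)) refl (X M) (Y M) (Z M) γ)
      (0≤+ (0≤- (x+γ≤y M (m⊔n≤o⇒n≤o Nz N₀ (z0≤ ≤ℕ-refl)))) (0≤- Z≤))
    decide : X M + 4δ ≤ Z M ⊎ Z M ≤ X M + 4δ → Cancellable (z -ᶜ real x) ⊎ Cancellable (z -ᶜ real y)
    decide (inj₁ X+4δ≤Z) = inj₁ (re-apart⇒cancellable (δ + δ) M 0<2δ λ n M≤n →
      ≤-trans (drift δ (X M) (X n) (Z M) (Z n) X+4δ≤Z (X-close n M≤n) (Z-close n M≤n)) (p≤∣p∣ (Z n - X n)))
    decide (inj₂ Z≤X+4δ) = inj₂ (re-apart⇒cancellable (δ + δ) M 0<2δ λ n M≤n →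
      ≤-trans (drift δ (Z M) (Z n) (Y M) (Y n) (Z+4δ≤Y Z≤X+4δ) (Z-close n M≤n) (Y-close n M≤n))
        (subst (_≤ ∣ Z n - Y n ∣) (solve 2 (λ z y → :- (z :- y) := y :- z) refl (Z n) (Y n)) (-p≤∣p∣ (Z n - Y n))))

  Separated-sym : ∀ {r s} → Separated r s → Separated s r
  Separated-sym sep z = swap (sep z)

-- Values of `f` at rationals: factorisation and signs of the cofactor

module RationalValues where

  open import Data.Integer.Base as ℤ using (+_)
  import Data.Integer.Properties as ℤ
  open import Data.Nat.Base as ℕ using (ℕ; zero; suc; _∸_; _!; z≤n; s≤s)
  import Data.Nat.Properties as ℕ
  open import Data.Rational.Base
  open import Data.Rational.Properties
  open import Data.Rational.Solver using (module +-*-Solver)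
  open import Relation.Binary.PropositionalEquality
  open +-*-Solver using (solve; _:=_; _:+_; _:*_; _:-_; :-_; con)
  open ≡-Reasoning
  open NullSequences
  open IntegerCasts
  open LinearInequalities

  ∑ : ℕ → (ℕ → ℚ) → ℚ
  ∑ zero    g = 0ℚ
  ∑ (suc n) g = ∑ n g + g (suc n)

  -- The Pochhammer symbol `(y + 1)ₐ`.
  rise : ℕ → ℚ → ℚ
  rise zero    y = 1ℚ
  rise (suc a) y = rise a y * (y + + suc a / 1)

  1/! : ℕ → ℚ
  1/! a = _/_ (+ 1) (a !) {{a ℕ.!≢0}}

  binomℚ : ℕ → ℚ → ℚ
  binomℚ a y = 1/! a * rise a y

  fℚ : ℕ → ℕ → ℚ → ℚ
  fℚ d p x = ∑ p λ j → binomℚ (j ∸ 1) (x - 1ℚ) * binomℚ (d ∸ j) x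

  ℕ/1-+ : ∀ m n → + (m ℕ.+ n) / 1 ≡ + m / 1 + + n / 1
  ℕ/1-+ m n = trans (cong (λ i → i / 1) (ℤ.pos-+ m n)) (/1-+ (+ m) (+ n))

  rise-+ : ∀ s e x → rise (s ℕ.+ e) x ≡ rise e x * rise s (x + + e / 1)
  rise-+ zero    e x = sym (*-identityʳ (rise e x))
  rise-+ (suc s) e x = begin
    rise (s ℕ.+ e) x * (x + + (suc s ℕ.+ e) / 1)
      ≡⟨ cong₂ (λ r t → r * (x + t)) (rise-+ s e x) (ℕ/1-+ (suc s) e) ⟩
    (rise e x * rise s (x + + e / 1)) * (x + (+ suc s / 1 + + e / 1))
      ≡⟨ solve 5 (λ r r′ x s e → (r :* r′) :* (x :+ (s :+ e)) := r :* (r′ :* ((x :+ e) :+ s))) refl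
           (rise e x) (rise s (x + + e / 1)) x (+ suc s / 1) (+ e / 1) ⟩
    rise e x * rise (suc s) (x + + e / 1) ∎

  rise-pred : ∀ i u → rise (suc i) (u - 1ℚ) ≡ u * rise i u
  rise-pred zero    u = solve 1 (λ u → con 1ℚ :* ((u :- con 1ℚ) :+ con 1ℚ) := u :* con 1ℚ) refl u
  rise-pred (suc i) u = begin
    rise (suc i) (u - 1ℚ) * ((u - 1ℚ) + + suc (suc i) / 1)
      ≡⟨ cong₂ (λ r t → r * ((u - 1ℚ) + t)) (rise-pred i u) (ℕ/1-suc (suc i)) ⟩
    (u * rise i u) * ((u - 1ℚ) + (+ suc i / 1 + 1ℚ))
      ≡⟨ solve 3 (λ u r i → (u :* r) :* ((u :- con 1ℚ) :+ (i :+ con 1ℚ)) := u :* (r :* (u :+ i))) refl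
           u (rise i u) (+ suc i / 1) ⟩
    u * rise (suc i) u ∎

  rise-pos : ∀ a y → 0ℚ ≤ y → 0ℚ < rise a y
  rise-pos zero    y 0≤y = positive⁻¹ 1ℚ
  rise-pos (suc a) y 0≤y = 0<* (rise-pos a y 0≤y) (+-mono-≤-< 0≤y (0<ℕ/1 a))

  1/!-suc : ∀ a → 1/! (suc a) * (+ suc a / 1) ≡ 1/! a
  1/!-suc a = begin
    1/! (suc a) * s
      ≡⟨ *-identityʳ (1/! (suc a) * s) ⟨
    1/! (suc a) * s * 1ℚ
      ≡⟨ cong (1/! (suc a) * s *_) (/1-*-reciprocal (a !) {{a ℕ.!≢0}}) ⟨
    1/! (suc a) * s * ((+ (a !) / 1) * 1/! a)
      ≡⟨ solve 4 (λ i s f j → i :* s :* (f :* j) := (s :* f) :* i :* j) refl (1/! (suc a)) s (+ (a !) / 1) (1/! a) ⟩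
    (s * (+ (a !) / 1)) * 1/! (suc a) * 1/! a
      ≡⟨ cong (λ t → t * 1/! (suc a) * 1/! a) (trans (cong (λ i → i / 1) (ℤ.pos-* (suc a) (a !))) (/1-* (+ suc a) (+ (a !)))) ⟨
    (+ (suc a !) / 1) * 1/! (suc a) * 1/! a
      ≡⟨ cong (_* 1/! a) (/1-*-reciprocal (suc a !) {{suc a ℕ.!≢0}}) ⟩
    1ℚ * 1/! a
      ≡⟨ *-identityˡ (1/! a) ⟩
    1/! a ∎
    where
    s : ℚ
    s = + suc a / 1

  0<1/! : ∀ a → 0ℚ < 1/! a
  0<1/! zero    = positive⁻¹ 1ℚ
  0<1/! (suc a) = *-cancelʳ-<-nonNeg (+ suc a / 1) {{nonNegative (0≤ℕ/1 (suc a))}}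
    (subst₂ _<_ (sym (*-zeroˡ (+ suc a / 1))) (sym (1/!-suc a)) (0<1/! a))

  -- In binomial notation, `C(u+i, i+1) = C(u+i+1, i+1) - C(u+i, i)`.
  binomℚ-pascal : ∀ i u → binomℚ (suc i) (u - 1ℚ) ≡ binomℚ (suc i) u - binomℚ i u
  binomℚ-pascal i u = begin
    1/! (suc i) * rise (suc i) (u - 1ℚ)
      ≡⟨ cong (1/! (suc i) *_) (rise-pred i u) ⟩
    1/! (suc i) * (u * rise i u)
      ≡⟨ solve 4 (λ v u r s → v :* (u :* r) := v :* (r :* (u :+ s)) :- v :* s :* r) refl
           (1/! (suc i)) u (rise i u) (+ suc i / 1) ⟩
    1/! (suc i) * rise (suc i) u - 1/! (suc i) * (+ suc i / 1) * rise i u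
      ≡⟨ cong (λ v → binomℚ (suc i) u - v * rise i u) (1/!-suc i) ⟩
    binomℚ (suc i) u - binomℚ i u ∎

  -- The Cauchy product `∑ a i * w (n - i)` without index subtraction. The recursion shifts `a` and
  -- leaves `w` alone, so the terms that Pascal's rule subtracts form a convolution with the same
  -- weights and a smaller `n`.
  conv : (a w : ℕ → ℚ) → ℕ → ℚ
  conv a w zero    = a 0 * w 0
  conv a w (suc n) = a 0 * w (suc n) + conv (λ i → a (suc i)) w n

  conv-congˡ : ∀ {a b} w n → (∀ i → a i ≡ b i) → conv a w n ≡ conv b w n
  conv-congˡ w zero    a≡b = cong (_* w 0) (a≡b 0)
  conv-congˡ w (suc n) a≡b = cong₂ (λ s t → s * w (suc n) + t) (a≡b 0) (conv-congˡ w n (λ i → a≡b (suc i)))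

  conv-sub : ∀ a b w n → conv (λ i → a i - b i) w n ≡ conv a w n - conv b w n
  conv-sub a b w zero    = solve 3 (λ a b w → (a :- b) :* w := a :* w :- b :* w) refl (a 0) (b 0) (w 0)
  conv-sub a b w (suc n) = begin
    (a 0 - b 0) * w (suc n) + conv (λ i → a (suc i) - b (suc i)) w n
      ≡⟨ cong (λ t → (a 0 - b 0) * w (suc n) + t) (conv-sub (λ i → a (suc i)) (λ i → b (suc i)) w n) ⟩
    (a 0 - b 0) * w (suc n) + (conv (λ i → a (suc i)) w n - conv (λ i → b (suc i)) w n)
      ≡⟨ solve 5 (λ a b w c d → (a :- b) :* w :+ (c :- d) := (a :* w :+ c) :- (b :* w :+ d)) refl
           (a 0) (b 0) (w (suc n)) (conv (λ i → a (suc i)) w n) (conv (λ i → b (suc i)) w n) ⟩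
    conv a w (suc n) - conv b w (suc n) ∎

  conv-zero : ∀ w n → conv (λ _ → 0ℚ) w n ≡ 0ℚ
  conv-zero w zero    = *-zeroˡ (w 0)
  conv-zero w (suc n) = cong₂ _+_ (*-zeroˡ (w (suc n))) (conv-zero w n)

  conv-scaleʳ : ∀ κ a w v n → (∀ s → v s ≡ κ * w s) → conv a v n ≡ κ * conv a w n
  conv-scaleʳ κ a w v zero    v≡ = begin
    a 0 * v 0         ≡⟨ cong (a 0 *_) (v≡ 0) ⟩
    a 0 * (κ * w 0)   ≡⟨ solve 3 (λ a κ w → a :* (κ :* w) := κ :* (a :* w)) refl (a 0) κ (w 0) ⟩
    κ * (a 0 * w 0)   ∎
  conv-scaleʳ κ a w v (suc n) v≡ = begin
    a 0 * v (suc n) + conv (λ i → a (suc i)) v n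
      ≡⟨ cong₂ (λ s t → a 0 * s + t) (v≡ (suc n)) (conv-scaleʳ κ (λ i → a (suc i)) w v n v≡) ⟩
    a 0 * (κ * w (suc n)) + κ * conv (λ i → a (suc i)) w n
      ≡⟨ solve 4 (λ a κ w c → a :* (κ :* w) :+ κ :* c := κ :* (a :* w :+ c)) refl
           (a 0) κ (w (suc n)) (conv (λ i → a (suc i)) w n) ⟩
    κ * conv a w (suc n) ∎

  ∑-front : ∀ n g → ∑ (suc n) g ≡ g 1 + ∑ n (λ i → g (suc i))
  ∑-front zero    g = trans (+-identityˡ (g 1)) (sym (+-identityʳ (g 1)))
  ∑-front (suc n) g = begin
    ∑ (suc n) g + g (suc (suc n))                           ≡⟨ cong (_+ g (suc (suc n))) (∑-front n g) ⟩
    (g 1 + ∑ n (λ i → g (suc i))) + g (suc (suc n))         ≡⟨ +-assoc (g 1) _ (g (suc (suc n))) ⟩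
    g 1 + (∑ n (λ i → g (suc i)) + g (suc (suc n)))         ∎

  ∑-cong : ∀ n {g h} → (∀ i → g (suc i) ≡ h (suc i)) → ∑ n g ≡ ∑ n h
  ∑-cong zero    g≡h = refl
  ∑-cong (suc n) g≡h = cong₂ _+_ (∑-cong n g≡h) (g≡h n)

  -- Reindexing by `i = j - 1`; the truncated subtractions are exact because `j ≤ suc q`.
  ∑≡conv : ∀ (a v : ℕ → ℚ) e q → ∑ (suc q) (λ j → a (j ∸ 1) * v (suc q ℕ.+ e ∸ j)) ≡ conv a (λ s → v (s ℕ.+ e)) q
  ∑≡conv a v e zero    = +-identityˡ (a 0 * v e)
  ∑≡conv a v e (suc q) = begin
    ∑ (suc (suc q)) (λ j → a (j ∸ 1) * v (suc (suc q) ℕ.+ e ∸ j))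
      ≡⟨ ∑-front (suc q) (λ j → a (j ∸ 1) * v (suc (suc q) ℕ.+ e ∸ j)) ⟩
    a 0 * v (suc q ℕ.+ e) + ∑ (suc q) (λ j → a j * v (suc q ℕ.+ e ∸ j))
      ≡⟨ cong (λ t → a 0 * v (suc q ℕ.+ e) + t) (trans (∑-cong (suc q) (λ _ → refl)) (∑≡conv (λ i → a (suc i)) v e q)) ⟩
    conv a (λ s → v (s ℕ.+ e)) (suc q) ∎

  alternating : ℕ → ℚ
  alternating zero    = 1ℚ
  alternating (suc k) = - alternating k

  alternating² : ∀ k → alternating k * alternating k ≡ 1ℚ
  alternating² zero    = refl
  alternating² (suc k) = trans
    (solve 1 (λ s → (:- s) :* (:- s) := s :* s) refl (alternating k)) (alternating² k)

  -- The number `-k` built by unit steps, so that `minus k - 1ℚ` is `minus (suc k)` by computation.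
  minus : ℕ → ℚ
  minus zero    = 0ℚ
  minus (suc k) = minus k - 1ℚ

  minus+ : ∀ k → minus k + + k / 1 ≡ 0ℚ
  minus+ zero    = refl
  minus+ (suc k) = begin
    minus k - 1ℚ + + suc k / 1        ≡⟨ cong (λ t → minus k - 1ℚ + t) (ℕ/1-suc k) ⟩
    minus k - 1ℚ + (+ k / 1 + 1ℚ)     ≡⟨ solve 2 (λ m k → m :- con 1ℚ :+ (k :+ con 1ℚ) := m :+ k) refl (minus k) (+ k / 1) ⟩
    minus k + + k / 1                 ≡⟨ minus+ k ⟩
    0ℚ                                ∎

  minus≡ : ∀ k → minus k ≡ (ℤ.- + k) / 1
  minus≡ k = begin
    minus k                         ≡⟨ solve 2 (λ m k → m := (m :+ k) :- k) refl (minus k) (+ k / 1) ⟩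
    (minus k + + k / 1) - + k / 1   ≡⟨ cong (_- + k / 1) (minus+ k) ⟩
    0ℚ - + k / 1                    ≡⟨ +-identityˡ (- (+ k / 1)) ⟩
    - (+ k / 1)                     ≡⟨ /1-neg (+ k) ⟨
    (ℤ.- + k) / 1                   ∎

  rise-vanishes : ∀ {k a} → 1 ℕ.≤ k → k ℕ.≤ a → rise a (minus k) ≡ 0ℚ
  rise-vanishes {k} {a} 1≤k k≤a = go (ℕ.≤⇒≤′ k≤a)
    where
    at-k : ∀ {k} → 1 ℕ.≤ k → rise k (minus k) ≡ 0ℚ
    at-k {suc k} _ = trans (cong (rise k (minus (suc k)) *_) (minus+ (suc k))) (*-zeroʳ (rise k (minus (suc k))))
    go : ∀ {a} → k ℕ.≤′ a → rise a (minus k) ≡ 0ℚ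
    go ℕ.≤′-refl              = at-k 1≤k
    go (ℕ.≤′-step {a} k≤′a) = trans (cong (_* (minus k + + suc a / 1)) (go k≤′a)) (*-zeroˡ (minus k + + suc a / 1))

  module _ (e : ℕ) where

    -- What is left of `binomℚ (s + e) x` after division by `rise e x`, with `y = x + e`.
    weight : ℚ → ℕ → ℚ
    weight y s = rise s y * 1/! (s ℕ.+ e)

    -- The cofactor with `u = x - 1` and `y = x + e` made independent, so that a step in `u` leaves
    -- the weights unchanged.
    G : ℕ → ℚ → ℚ → ℚ
    G q u y = conv (λ i → binomℚ i u) (weight y) q

    cofactor : ℕ → ℚ → ℚ
    cofactor q x = G q (x - 1ℚ) (x + + e / 1)

    fℚ-factor : ∀ q x → fℚ (suc q ℕ.+ e) (suc q) x ≡ rise e x * cofactor q x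
    fℚ-factor q x = trans
      (∑≡conv (λ i → binomℚ i (x - 1ℚ)) (λ n → binomℚ n x) e q)
      (conv-scaleʳ (rise e x) (λ i → binomℚ i (x - 1ℚ)) (weight (x + + e / 1)) _ q λ s → begin
        1/! (s ℕ.+ e) * rise (s ℕ.+ e) x
          ≡⟨ cong (1/! (s ℕ.+ e) *_) (rise-+ s e x) ⟩
        1/! (s ℕ.+ e) * (rise e x * rise s (x + + e / 1))
          ≡⟨ solve 3 (λ i r r′ → i :* (r :* r′) := r :* (r′ :* i)) refl
               (1/! (s ℕ.+ e)) (rise e x) (rise s (x + + e / 1)) ⟩
        rise e x * weight (x + + e / 1) s ∎)

    -- The summand `i = 0` does not depend on `u`; in the others Pascal's rule subtracts terms whose
    -- index is lower by one, and these add up to `G q u y`.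
    G-difference : ∀ q u y → G (suc q) (u - 1ℚ) y ≡ G (suc q) u y - G q u y
    G-difference q u y = begin
      b₀ * w (suc q) + conv (λ i → binomℚ (suc i) (u - 1ℚ)) w q
        ≡⟨ cong (λ t → b₀ * w (suc q) + t) (trans (conv-congˡ w q (λ i → binomℚ-pascal i u))
             (conv-sub (λ i → binomℚ (suc i) u) (λ i → binomℚ i u) w q)) ⟩
      b₀ * w (suc q) + (conv (λ i → binomℚ (suc i) u) w q - G q u y)
        ≡⟨ +-assoc (b₀ * w (suc q)) (conv (λ i → binomℚ (suc i) u) w q) (- G q u y) ⟨
      G (suc q) u y - G q u y ∎
      where
      b₀ = 1ℚ * 1ℚ
      w = weight y

    -- For `i ≥ 1` the polynomial `binomℚ i` has the root `-1`, so only the summand `i = 0`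
    -- survives.
    G-at-minus-one : ∀ q y → G q (minus 1) y ≡ weight y q
    G-at-minus-one zero    y = *-identityˡ (weight y 0)
    G-at-minus-one (suc q) y = begin
      1ℚ * weight y (suc q) + conv (λ i → binomℚ (suc i) (minus 1)) (weight y) q
        ≡⟨ cong (λ t → 1ℚ * weight y (suc q) + t) (trans (conv-congˡ (weight y) q binom-zero) (conv-zero (weight y) q)) ⟩
      1ℚ * weight y (suc q) + 0ℚ
        ≡⟨ solve 1 (λ w → con 1ℚ :* w :+ con 0ℚ := w) refl (weight y (suc q)) ⟩
      weight y (suc q) ∎
      where
      binom-zero : ∀ i → binomℚ (suc i) (minus 1) ≡ 0ℚ
      binom-zero i = begin
        1/! (suc i) * rise (suc i) (0ℚ - 1ℚ)   ≡⟨ cong (1/! (suc i) *_) (rise-pred i 0ℚ) ⟩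
        1/! (suc i) * (0ℚ * rise i 0ℚ)         ≡⟨ solve 2 (λ a b → a :* (con 0ℚ :* b) := con 0ℚ) refl (1/! (suc i)) (rise i 0ℚ) ⟩
        0ℚ                                     ∎

    -- Each unit step to the left is a difference in q, which turns the factor
    -- y + (r + 1) of rise (r + 1) y into -(c + k).
    G-at-minus : ∀ k r y → G (k ℕ.+ r) (minus (suc k)) y ≡
      alternating k * rise k (+ e / 1 - y - 1ℚ) * rise r y * 1/! (k ℕ.+ r ℕ.+ e)
    G-at-minus zero    r y = trans (G-at-minus-one r y)
      (solve 2 (λ r i → r :* i := con 1ℚ :* con 1ℚ :* r :* i) refl (rise r y) (1/! (r ℕ.+ e)))
    G-at-minus (suc k) r y = begin
      G (suc (k ℕ.+ r)) (minus (suc k) - 1ℚ) y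
        ≡⟨ G-difference (k ℕ.+ r) (minus (suc k)) y ⟩
      G (suc (k ℕ.+ r)) (minus (suc k)) y - G (k ℕ.+ r) (minus (suc k)) y
        ≡⟨ cong₂ _-_ (trans (cong (λ q → G q (minus (suc k)) y) (sym (ℕ.+-suc k r)))
             (trans (G-at-minus k (suc r) y)
               (cong (λ q → σ * c * rise (suc r) y * 1/! (q ℕ.+ e)) (ℕ.+-suc k r))))
             (trans (G-at-minus k r y) (cong (σ * c * rise r y *_) (sym (1/!-suc (k ℕ.+ r ℕ.+ e))))) ⟩
      σ * c * (rise r y * (y + + suc r / 1)) * i - σ * c * rise r y * (i * (+ suc (k ℕ.+ r ℕ.+ e) / 1))
        ≡⟨ cong₂ (λ s t → σ * c * (rise r y * (y + s)) * i - σ * c * rise r y * (i * t)) (ℕ/1-suc r)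
             (trans (ℕ/1-suc (k ℕ.+ r ℕ.+ e)) (cong (_+ 1ℚ) (trans (ℕ/1-+ (k ℕ.+ r) e) (cong (_+ + e / 1) (ℕ/1-+ k r))))) ⟩
      σ * c * (rise r y * (y + (r′ + 1ℚ))) * i - σ * c * rise r y * (i * (k′ + r′ + e′ + 1ℚ))
        ≡⟨ solve 8 (λ σ c R i y r k e →
               σ :* c :* (R :* (y :+ (r :+ con 1ℚ))) :* i :- σ :* c :* R :* (i :* (k :+ r :+ e :+ con 1ℚ)) :=
               (:- σ) :* (c :* (e :- y :- con 1ℚ :+ (k :+ con 1ℚ))) :* R :* i) refl
             σ c (rise r y) i y r′ k′ e′ ⟩
      (- σ) * (c * (e′ - y - 1ℚ + (k′ + 1ℚ))) * rise r y * i
        ≡⟨ cong (λ t → (- σ) * (c * (e′ - y - 1ℚ + t)) * rise r y * i) (ℕ/1-suc k) ⟨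
      alternating (suc k) * rise (suc k) (e′ - y - 1ℚ) * rise r y * i ∎
      where
      σ = alternating k
      c = rise k (+ e / 1 - y - 1ℚ)
      i = 1/! (suc (k ℕ.+ r ℕ.+ e))
      k′ = + k / 1
      r′ = + r / 1
      e′ = + e / 1

    -- At `x = -k` one has `u = -(k + 1)` and `y = e - k`, so `e - y - 1 = k - 1` and the first
    -- product is `k(k+1)⋯(2k-1)`. For `r ≥ 1` the hypothesis gives `k ≤ e`, that is `y ≥ 0`, which
    -- makes `rise r y` positive.
    cofactor-sign : ∀ k r → k ℕ.+ r ℕ.≤ suc e → 0ℚ < alternating k * cofactor (k ℕ.+ r) (minus k)
    cofactor-sign k r k+r≤1+e = subst (0ℚ <_) (sym eq)
      (0<* (0<* (rise-k-pos k) (rise-r-pos r k+r≤1+e)) (0<1/! (k ℕ.+ r ℕ.+ e)))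
      where
      y = minus k + + e / 1
      σ = alternating k
      eq : σ * cofactor (k ℕ.+ r) (minus k) ≡ rise k (+ k / 1 - 1ℚ) * rise r y * 1/! (k ℕ.+ r ℕ.+ e)
      eq = begin
        σ * G (k ℕ.+ r) (minus (suc k)) y
          ≡⟨ cong (σ *_) (G-at-minus k r y) ⟩
        σ * (σ * rise k (+ e / 1 - y - 1ℚ) * rise r y * 1/! (k ℕ.+ r ℕ.+ e))
          ≡⟨ solve 4 (λ s a b c → s :* (s :* a :* b :* c) := s :* s :* (a :* b :* c)) refl
               σ (rise k (+ e / 1 - y - 1ℚ)) (rise r y) (1/! (k ℕ.+ r ℕ.+ e)) ⟩
        σ * σ * (rise k (+ e / 1 - y - 1ℚ) * rise r y * 1/! (k ℕ.+ r ℕ.+ e))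
          ≡⟨ cong₂ (λ s t → s * (rise k t * rise r y * 1/! (k ℕ.+ r ℕ.+ e))) (alternating² k) (begin
               + e / 1 - y - 1ℚ
                 ≡⟨ solve 3 (λ e m k → e :- (m :+ e) :- con 1ℚ := (k :- con 1ℚ) :- (m :+ k)) refl
                      (+ e / 1) (minus k) (+ k / 1) ⟩
               (+ k / 1 - 1ℚ) - (minus k + + k / 1)
                 ≡⟨ cong (λ t → (+ k / 1 - 1ℚ) - t) (minus+ k) ⟩
               (+ k / 1 - 1ℚ) - 0ℚ
                 ≡⟨ +-identityʳ (+ k / 1 - 1ℚ) ⟩
               + k / 1 - 1ℚ ∎) ⟩
        1ℚ * (rise k (+ k / 1 - 1ℚ) * rise r y * 1/! (k ℕ.+ r ℕ.+ e))
          ≡⟨ *-identityˡ _ ⟩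
        rise k (+ k / 1 - 1ℚ) * rise r y * 1/! (k ℕ.+ r ℕ.+ e) ∎
      rise-k-pos : ∀ k → 0ℚ < rise k (+ k / 1 - 1ℚ)
      rise-k-pos zero    = positive⁻¹ 1ℚ
      rise-k-pos (suc k) = rise-pos (suc k) (+ suc k / 1 - 1ℚ)
        (0≤- (/1-mono-≤ (+ 1) (+ suc k) (ℤ.+≤+ (s≤s z≤n))))
      -- For r = 0 the base y may be -1.
      rise-r-pos : ∀ r → k ℕ.+ r ℕ.≤ suc e → 0ℚ < rise r y
      rise-r-pos zero    _ = positive⁻¹ 1ℚ
      rise-r-pos (suc r) k+1+r≤1+e = rise-pos (suc r) y (subst (0ℚ ≤_)
        (begin
          + e / 1 - + k / 1                         ≡⟨ solve 3 (λ e k m → e :- k := (m :+ e) :- (m :+ k)) refl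
                                                         (+ e / 1) (+ k / 1) (minus k) ⟩
          (minus k + + e / 1) - (minus k + + k / 1) ≡⟨ cong (λ t → (minus k + + e / 1) - t) (minus+ k) ⟩
          (minus k + + e / 1) - 0ℚ                  ≡⟨ +-identityʳ (minus k + + e / 1) ⟩
          y                                         ∎)
        (0≤- (/1-mono-≤ (+ k) (+ e) (ℤ.+≤+
          (ℕ.≤-trans (ℕ.m≤m+n k r) (ℕ.s≤s⁻¹ (subst (ℕ._≤ suc e) (ℕ.+-suc k r) k+1+r≤1+e)))))))

-- Lipschitz constants for the cofactor on an interval

module Lipschitz where

  open import Data.Integer.Base using (+_)
  open import Data.Nat.Base as ℕ using (ℕ; zero; suc)
  open import Data.Product.Base using (∃; _×_; _,_)
  open import Data.Rational.Base
  open import Data.Rational.Properties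
  open import Data.Rational.Solver using (module +-*-Solver)
  open import Relation.Binary.PropositionalEquality using (refl; cong)
  open +-*-Solver using (solve; _:=_; _:+_; _:*_; _:-_; :-_; con)
  open NullSequences
  open LinearInequalities
  open Bisection
  open RationalValues

  module On (a b : ℚ) where

    -- A product is Lipschitz only if its factors are also bounded, so one constant carries both
    -- properties. It is positive because bisection divides by it.
    BoundedLipschitz : (ℚ → ℚ) → Set
    BoundedLipschitz g = ∃ λ K → 0ℚ < K × (∀ x → a ≤ x → x ≤ b → ∣ g x ∣ ≤ K) × LipschitzOn K a b g

    lipschitz-const : ∀ κ → BoundedLipschitz (λ _ → κ)
    lipschitz-const κ =
      1ℚ + ∣ κ ∣ , 0<K ,
      (λ _ _ _ → -≥0 (solve 1 (λ k → (con 1ℚ :+ k) :- k := con 1ℚ) refl ∣ κ ∣) (<⇒≤ (positive⁻¹ 1ℚ))) ,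
      (λ x y _ _ _ _ → ≤-trans (≤-reflexive (cong ∣_∣ (+-inverseʳ κ))) (0≤* (<⇒≤ 0<K) (0≤∣p∣ (x - y))))
      where
      0<K : 0ℚ < 1ℚ + ∣ κ ∣
      0<K = 0<+ (positive⁻¹ 1ℚ) (0≤∣p∣ κ)

    lipschitz-id : BoundedLipschitz (λ x → x)
    lipschitz-id =
      -- The summand `1ℚ` is the Lipschitz constant of the identity; `∣ a ∣ + ∣ b ∣` bounds it on
      -- the interval.
      1ℚ + (∣ a ∣ + ∣ b ∣) , 0<+ (positive⁻¹ 1ℚ) 0≤ ,
      (λ x a≤x x≤b → ∣p∣≤
        (≤-trans (≤-trans x≤b (p≤∣p∣ b)) (-≥0 (solve 2 (λ a b → (con 1ℚ :+ (a :+ b)) :- b := con 1ℚ :+ a) refl ∣ a ∣ ∣ b ∣)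
          (0≤+ (<⇒≤ (positive⁻¹ 1ℚ)) (0≤∣p∣ a))))
        (≤-trans (≤-trans (neg-antimono-≤ a≤x) (-p≤∣p∣ a)) (-≥0 (solve 2 (λ a b → (con 1ℚ :+ (a :+ b)) :- a := con 1ℚ :+ b) refl ∣ a ∣ ∣ b ∣)
          (0≤+ (<⇒≤ (positive⁻¹ 1ℚ)) (0≤∣p∣ b))))) ,
      (λ x y _ _ _ _ → -≥0 (solve 2 (λ s d → (con 1ℚ :+ s) :* d :- d := s :* d) refl (∣ a ∣ + ∣ b ∣) ∣ x - y ∣)
        (0≤* 0≤ (0≤∣p∣ (x - y))))
      where
      0≤ : 0ℚ ≤ ∣ a ∣ + ∣ b ∣
      0≤ = 0≤+ (0≤∣p∣ a) (0≤∣p∣ b)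

    lipschitz-+ : ∀ {g h} → BoundedLipschitz g → BoundedLipschitz h → BoundedLipschitz (λ x → g x + h x)
    lipschitz-+ {g} {h} (K , 0<K , g≤ , g-lip) (L , 0<L , h≤ , h-lip) =
      K + L , 0<+ 0<K (<⇒≤ 0<L) ,
      (λ x a≤x x≤b → ≤-trans (∣p+q∣≤∣p∣+∣q∣ (g x) (h x)) (+-mono-≤ (g≤ x a≤x x≤b) (h≤ x a≤x x≤b))) ,
      (λ x y a≤x x≤b a≤y y≤b → begin
        ∣ (g x + h x) - (g y + h y) ∣     ≡⟨ cong ∣_∣ (solve 4 (λ a b c d → (a :+ b) :- (c :+ d) := (a :- c) :+ (b :- d)) refl
                                               (g x) (h x) (g y) (h y)) ⟩
        ∣ (g x - g y) + (h x - h y) ∣     ≤⟨ ∣p+q∣≤∣p∣+∣q∣ (g x - g y) (h x - h y) ⟩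
        ∣ g x - g y ∣ + ∣ h x - h y ∣     ≤⟨ +-mono-≤ (g-lip x y a≤x x≤b a≤y y≤b) (h-lip x y a≤x x≤b a≤y y≤b) ⟩
        K * ∣ x - y ∣ + L * ∣ x - y ∣     ≡⟨ *-distribʳ-+ ∣ x - y ∣ K L ⟨
        (K + L) * ∣ x - y ∣               ∎)
      where open ≤-Reasoning

    ∣*∣-mono : ∀ p q {P Q} → 0ℚ ≤ P → ∣ p ∣ ≤ P → ∣ q ∣ ≤ Q → ∣ p * q ∣ ≤ P * Q
    ∣*∣-mono p q {P} {Q} 0≤P p≤P q≤Q = begin
      ∣ p * q ∣       ≡⟨ ∣p*q∣≡∣p∣*∣q∣ p q ⟩
      ∣ p ∣ * ∣ q ∣   ≤⟨ *-monoʳ-≤-nonNeg ∣ q ∣ {{∣-∣-nonNeg q}} p≤P ⟩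
      P * ∣ q ∣       ≤⟨ *-monoˡ-≤-nonNeg P {{nonNegative 0≤P}} q≤Q ⟩
      P * Q           ∎
      where open ≤-Reasoning

    lipschitz-* : ∀ {g h} → BoundedLipschitz g → BoundedLipschitz h → BoundedLipschitz (λ x → g x * h x)
    lipschitz-* {g} {h} (K , 0<K , g≤ , g-lip) (L , 0<L , h≤ , h-lip) =
      K * L + K * L , 0<+ 0<KL (<⇒≤ 0<KL) ,
      (λ x a≤x x≤b → ≤-trans (∣*∣-mono (g x) (h x) (<⇒≤ 0<K) (g≤ x a≤x x≤b) (h≤ x a≤x x≤b))
        (-≥0 (solve 1 (λ k → (k :+ k) :- k := k) refl (K * L)) (<⇒≤ 0<KL))) ,
      (λ x y a≤x x≤b a≤y y≤b → begin
        ∣ g x * h x - g y * h y ∣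
          ≡⟨ cong ∣_∣ (solve 4 (λ a b c d → a :* b :- c :* d := a :* (b :- d) :+ d :* (a :- c)) refl
               (g x) (h x) (g y) (h y)) ⟩
        ∣ g x * (h x - h y) + h y * (g x - g y) ∣
          ≤⟨ ∣p+q∣≤∣p∣+∣q∣ (g x * (h x - h y)) (h y * (g x - g y)) ⟩
        ∣ g x * (h x - h y) ∣ + ∣ h y * (g x - g y) ∣
          ≤⟨ +-mono-≤ (∣*∣-mono (g x) (h x - h y) (<⇒≤ 0<K) (g≤ x a≤x x≤b) (h-lip x y a≤x x≤b a≤y y≤b))
                      (∣*∣-mono (h y) (g x - g y) (<⇒≤ 0<L) (h≤ y a≤y y≤b) (g-lip x y a≤x x≤b a≤y y≤b)) ⟩
        K * (L * ∣ x - y ∣) + L * (K * ∣ x - y ∣)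
          ≡⟨ solve 3 (λ k l d → k :* (l :* d) :+ l :* (k :* d) := (k :* l :+ k :* l) :* d) refl K L ∣ x - y ∣ ⟩
        (K * L + K * L) * ∣ x - y ∣ ∎)
      where
      open ≤-Reasoning
      0<KL : 0ℚ < K * L
      0<KL = 0<* 0<K 0<L

    lipschitz-rise : ∀ i {g} → BoundedLipschitz g → BoundedLipschitz (λ x → rise i (g x))
    lipschitz-rise zero    lg = lipschitz-const 1ℚ
    lipschitz-rise (suc i) lg = lipschitz-* (lipschitz-rise i lg) (lipschitz-+ lg (lipschitz-const (+ suc i / 1)))

    lipschitz-conv : ∀ {a w : ℕ → ℚ → ℚ} n → (∀ i → BoundedLipschitz (a i)) → (∀ s → BoundedLipschitz (w s)) →
      BoundedLipschitz (λ x → conv (λ i → a i x) (λ s → w s x) n)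
    lipschitz-conv zero    la lw = lipschitz-* (la 0) (lw 0)
    lipschitz-conv (suc n) la lw =
      lipschitz-+ (lipschitz-* (la 0) (lw (suc n))) (lipschitz-conv n (λ i → la (suc i)) lw)

    lipschitz-cofactor : ∀ e q → BoundedLipschitz (cofactor e q)
    lipschitz-cofactor e q = lipschitz-conv q
      (λ i → lipschitz-* (lipschitz-const (1/! i)) (lipschitz-rise i (lipschitz-+ lipschitz-id (lipschitz-const (- 1ℚ)))))
      (λ s → lipschitz-* (lipschitz-rise s (lipschitz-+ lipschitz-id (lipschitz-const (+ e / 1)))) (lipschitz-const (1/! (s ℕ.+ e))))

-- A root of `f` strictly between `-(k + 1)` and `-k`

module RealRoots where

  open import Data.Integer.Base as ℤ using (+_)
  open import Data.Nat.Base as ℕ using (ℕ; suc; _∸_)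
  import Data.Nat.Properties as ℕ
  open import Data.Product.Base using (∃; _×_; _,_)
  open import Data.Rational.Base
  open import Data.Rational.Properties
  open import Data.Rational.Solver using (module +-*-Solver)
  open import Relation.Binary.PropositionalEquality using (_≡_; refl; sym; trans; cong; subst)
  open +-*-Solver using (solve; _:=_; _:+_; _:*_; _:-_; :-_; con)
  open NullSequences
  open LinearInequalities
  open Bisection
  open RationalValues

  cofactor-sign′ : ∀ {e q k} → q ℕ.≤ suc e → k ℕ.≤ q → 0ℚ < alternating k * cofactor e q (minus k)
  cofactor-sign′ {e} {q} {k} q≤1+e k≤q =
    subst (λ n → n ℕ.≤ suc e → 0ℚ < alternating k * cofactor e n (minus k))
      (ℕ.m+[n∸m]≡n k≤q) (cofactor-sign e k (q ∸ k)) q≤1+e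

  abstract
    -- Bisection is applied to `h = (-1)ᵏ * cofactor`, the sign making `h` pass from negative to
    -- positive. Since `σ * σ` is 1, `fℚ` equals `rise e x * σ * h x`, a bounded factor times a null
    -- one along the bisection sequence. Being `abstract`, that sequence does not unfold where the
    -- root is used.
    root-between : ∀ {e q} k → q ℕ.≤ suc e → suc k ℕ.≤ q → ∃ λ α →
      fromℤ (ℤ.- + suc k) <ᴿ α × α <ᴿ fromℤ (ℤ.- + k) × Null (λ n → fℚ (suc q ℕ.+ e) (suc q) (seq α n))
    root-between {e} {q} k q≤1+e k<q =
      let open Lipschitz.On a (a + 1ℚ)
          K , 0<K , _ , h-lip = lipschitz-* (lipschitz-const σ) (lipschitz-cofactor e q)
          B , 0<B , rise≤ , _ = lipschitz-* (lipschitz-rise e lipschitz-id) (lipschitz-const σ)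
          α = root h a K 0<K h-lip ha<0 0<hb
      in α ,
         subst (λ r → fromℚ r <ᴿ α) (minus≡ (suc k)) (a<root h a K 0<K h-lip ha<0 0<hb) ,
         subst (λ r → α <ᴿ fromℚ r) (trans a+1≡ (minus≡ k)) (root<b h a K 0<K h-lip ha<0 0<hb) ,
         null-cong (λ n → sym (fℚ≡ (seq α n)))
           (null-* {λ n → rise e (seq α n) * σ} {λ n → h (seq α n)}
             -- `Bounded` asks for a strict bound, whence `B + 1ℚ`.
             (B + 1ℚ , 0<+ 0<B (<⇒≤ (positive⁻¹ 1ℚ)) , 0 , λ n _ →
               ≤-<-trans (rise≤ (seq α n) (a≤left h a K 0<K h-lip ha<0 0<hb n) (left≤b h a K 0<K h-lip ha<0 0<hb n))
                 (->0 (solve 1 (λ b → (b :+ con 1ℚ) :- b := con 1ℚ) refl B) (positive⁻¹ 1ℚ)))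
             (root-null h a K 0<K h-lip ha<0 0<hb))
      where
      σ a : ℚ
      σ = alternating k
      a = minus (suc k)
      h : ℚ → ℚ
      h x = σ * cofactor e q x
      a+1≡ : a + 1ℚ ≡ minus k
      a+1≡ = solve 1 (λ m → (m :- con 1ℚ) :+ con 1ℚ := m) refl (minus k)
      ha<0 : h a < 0ℚ
      ha<0 = ->0 (solve 2 (λ s c → con 0ℚ :- s :* c := (:- s) :* c) refl σ (cofactor e q a)) (cofactor-sign′ q≤1+e k<q)
      0<hb : 0ℚ < h (a + 1ℚ)
      0<hb = subst (λ x → 0ℚ < h x) (sym a+1≡) (cofactor-sign′ q≤1+e (ℕ.<⇒≤ k<q))
      fℚ≡ : ∀ x → fℚ (suc q ℕ.+ e) (suc q) x ≡ rise e x * σ * h x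
      fℚ≡ x = trans (fℚ-factor e q x) (trans
        (solve 2 (λ r c → r :* c := r :* (con 1ℚ :* c)) refl (rise e x) (cofactor e q x))
        (trans (cong (λ t → rise e x * (t * cofactor e q x)) (sym (alternating² k)))
          (solve 3 (λ r s c → r :* (s :* s :* c) := r :* s :* (s :* c)) refl (rise e x) σ (cofactor e q x))))

-- The set of complex roots of `f`

module RootSet where

  open import Data.Fin.Base using (Fin; toℕ)
  open import Data.Fin.Properties using (toℕ<n)
  open import Data.Integer.Base as ℤ using (ℤ; +_)
  import Data.Integer.Properties as ℤ
  open import Data.Integer.Solver using (module +-*-Solver)
  open import Data.List.Base using (List; _++_; length; tabulate)
  open import Data.List.Properties using (length-++; length-tabulate)
  open import Data.List.Relation.Unary.All using (All)
  open import Data.List.Relation.Unary.All.Properties as All using ()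
  open import Data.List.Relation.Unary.AllPairs using (AllPairs)
  import Data.List.Relation.Unary.AllPairs.Properties as AllPairs
  open import Data.List.Relation.Unary.Any using (Any)
  import Data.List.Relation.Unary.Any.Properties as Any
  open import Data.Nat.Base as ℕ using (ℕ; zero; suc; _∸_; z≤n; s≤s)
  import Data.Nat.Properties as ℕ
  open import Data.Product.Base using (∃; Σ; _×_; _,_; proj₁; proj₂)
  open import Data.Rational.Base
  open import Data.Rational.Properties
  import Data.Rational.Solver as ℚ
  open import Data.Sum.Base as ⊎ using (_⊎_; inj₁; inj₂)
  open import Function.Base using (_∘_)
  open import Function.Bundles using (_⇔_; mk⇔)
  open import Relation.Binary.PropositionalEquality using (_≡_; refl; sym; trans; cong; cong₂; subst)
  open NullSequences
  open IntegerCasts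
  open LinearInequalities
  open ComplexRing
  open ComplexSeparation
  open RationalValues
  open RealRoots

  -- Evaluation one index at a time: at a real argument every operation in `f` acts on rational
  -- terms with vanishing imaginary part, so `f` can be followed through its definition without
  -- equational reasoning in `ℂ`.
  record RationalAt (n : ℕ) (z : ℂ) (q : ℚ) : Set where
    constructor at
    field
      re-at : seq (re z) n ≡ q
      im-at : seq (im z) n ≡ 0ℚ
  open RationalAt

  at-+ : ∀ {n z w p q} → RationalAt n z p → RationalAt n w q → RationalAt n (z +ᶜ w) (p + q)
  at-+ (at r i) (at r′ i′) = at (cong₂ _+_ r r′) (cong₂ _+_ i i′)

  at-- : ∀ {n z w p q} → RationalAt n z p → RationalAt n w q → RationalAt n (z -ᶜ w) (p - q)
  at-- (at r i) (at r′ i′) = at (cong₂ _-_ r r′) (cong₂ _-_ i i′)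

  at-* : ∀ {n z w p q} → RationalAt n z p → RationalAt n w q → RationalAt n (z *ᶜ w) (p * q)
  at-* {p = p} {q} (at r i) (at r′ i′) = at
    (trans (cong₂ _-_ (cong₂ _*_ r r′) (cong₂ _*_ i i′))
      (solve 2 (λ p q → p :* q :- con 0ℚ :* con 0ℚ := p :* q) refl p q))
    (trans (cong₂ _+_ (cong₂ _*_ r i′) (cong₂ _*_ i r′))
      (solve 2 (λ p q → p :* con 0ℚ :+ con 0ℚ :* q := con 0ℚ) refl p q))
    where open ℚ.+-*-Solver

  at-rat : ∀ {n} q → RationalAt n (ratᶜ q) q
  at-rat q = at refl refl

  at-∑₁ : ∀ {n} p {g : ℕ → ℂ} {h : ℕ → ℚ} → (∀ j → RationalAt n (g j) (h j)) → RationalAt n (∑₁ p g) (∑ p h)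
  at-∑₁ zero    gh = at-rat 0ℚ
  at-∑₁ (suc p) gh = at-+ (at-∑₁ p gh) (gh (suc p))

  at-rise : ∀ {n} a {z y} → RationalAt n z y → RationalAt n (∏₁ a (λ i → z +ᶜ intᶜ (+ i))) (rise a y)
  at-rise zero    zy = at-rat 1ℚ
  at-rise (suc a) zy = at-* (at-rise a zy) (at-+ zy (at-rat (+ suc a / 1)))

  at-binom : ∀ {n} a {z y} → RationalAt n z y → RationalAt n (binom a z) (binomℚ a y)
  at-binom a zy = at-* (at-rat (1/! a)) (at-rise a zy)

  at-f : ∀ d p x n → RationalAt n (f d p (real x)) (fℚ d p (seq x n))
  at-f d p x n = at-∑₁ p λ j → at-* (at-binom (j ∸ 1) (at-- x-at (at-rat 1ℚ))) (at-binom (d ∸ j) x-at)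
    where
    x-at : RationalAt n (real x) (seq x n)
    x-at = at refl refl

  fℚ-null⇒root : ∀ d p x → Null (λ n → fℚ d p (seq x n)) → IsRoot (f d p) (real x)
  fℚ-null⇒root d p x f→0 = mk≃ᶜ
    (mk≃ᴿ (null-cong (λ n → sym (trans (+-identityʳ _) (re-at (at-f d p x n)))) f→0))
    (≡⇒≃ᴿ λ n → im-at (at-f d p x n))

  IsPoly-∏₁ : ∀ a {g} → IsPoly 1 g → IsPoly a (λ z → ∏₁ a (λ i → g z +ᶜ intᶜ (+ i)))
  IsPoly-∏₁ zero    {g} pg = IsPoly-const (intᶜ (+ 1))
  IsPoly-∏₁ (suc a) {g} pg = subst (λ n → IsPoly n (λ z → ∏₁ (suc a) (λ i → g z +ᶜ intᶜ (+ i)))) (ℕ.+-comm a 1)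
    (IsPoly-* a 1 (IsPoly-∏₁ a pg) (IsPoly-+ 1 pg (IsPoly-suc 0 (IsPoly-const (intᶜ (+ suc a))))))

  IsPoly-binom : ∀ a {g} → IsPoly 1 g → IsPoly a (λ z → binom a (g z))
  IsPoly-binom a pg = IsPoly-*₀ a (IsPoly-const (ratᶜ (1/! a))) (IsPoly-∏₁ a pg)

  IsPoly-∑₁ : ∀ N p {g : ℕ → ℂ → ℂ} → (∀ j → 1 ℕ.≤ j → j ℕ.≤ p → IsPoly N (g j)) → IsPoly N (λ z → ∑₁ p (λ j → g j z))
  IsPoly-∑₁ N zero    pg = IsPoly-mono {0} {N} z≤n (IsPoly-const (intᶜ (+ 0)))
  IsPoly-∑₁ N (suc p) pg = IsPoly-+ N
    (IsPoly-∑₁ N p (λ j 1≤j j≤p → pg j 1≤j (ℕ.m≤n⇒m≤1+n j≤p))) (pg (suc p) (s≤s z≤n) ℕ.≤-refl)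

  -- The summand at `j` has degree `(j - 1) + (d - j) = d - 1`, which is `q + e` for every `j`.
  IsPoly-f : ∀ q e → IsPoly (q ℕ.+ e) (f (suc q ℕ.+ e) (suc q))
  IsPoly-f q e = IsPoly-∑₁ (q ℕ.+ e) (suc q) term
    where
    term : ∀ j → 1 ℕ.≤ j → j ℕ.≤ suc q →
      IsPoly (q ℕ.+ e) (λ z → binom (j ∸ 1) (z -ᶜ intᶜ (+ 1)) *ᶜ binom (suc q ℕ.+ e ∸ j) z)
    term (suc i) _ (s≤s i≤q) = subst (λ n → IsPoly n (λ z → binom i (z -ᶜ intᶜ (+ 1)) *ᶜ binom (q ℕ.+ e ∸ i) z))
      (ℕ.m+[n∸m]≡n (ℕ.≤-trans i≤q (ℕ.m≤m+n q e)))
      (IsPoly-* i (q ℕ.+ e ∸ i)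
        (IsPoly-binom i (IsPoly-+ 1 IsPoly-id (IsPoly-suc 0 (IsPoly-const (-ᶜ intᶜ (+ 1))))))
        (IsPoly-binom (q ℕ.+ e ∸ i) IsPoly-id))

  fromℤ-mono-< : ∀ {i j} → i ℤ.< j → fromℤ i <ᴿ fromℤ j
  fromℤ-mono-< {i} {j} i<j = mk<ᴿ (j / 1 - i / 1) (0<- (/1-mono-< i j i<j)) 0 λ _ _ →
    ≤-reflexive (solve 2 (λ i j → i :+ (j :- i) := j) refl (i / 1) (j / 1))
    where open ℚ.+-*-Solver

  <ᴿ-fromℤ-≤ : ∀ {x i j} → x <ᴿ fromℤ i → i ℤ.≤ j → x <ᴿ fromℤ j
  <ᴿ-fromℤ-≤ {i = i} {j} (mk<ᴿ γ 0<γ N x+γ≤i) i≤j = mk<ᴿ γ 0<γ N λ n N≤n → ≤-trans (x+γ≤i n N≤n) (/1-mono-≤ i j i≤j)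

  fromℤ-≤-<ᴿ : ∀ {i j x} → i ℤ.≤ j → fromℤ j <ᴿ x → fromℤ i <ᴿ x
  fromℤ-≤-<ᴿ {i} {j} i≤j (mk<ᴿ γ 0<γ N j+γ≤x) = mk<ᴿ γ 0<γ N λ n N≤n → ≤-trans (+-monoˡ-≤ γ (/1-mono-≤ i j i≤j)) (j+γ≤x n N≤n)

  <ᴿ-trans : ∀ {x y z} → x <ᴿ y → y <ᴿ z → x <ᴿ z
  <ᴿ-trans {x} {y} {z} (mk<ᴿ γ 0<γ M x+γ≤y) (mk<ᴿ δ 0<δ N y+δ≤z) = mk<ᴿ γ 0<γ (M ℕ.⊔ N) λ n M⊔N≤n → ≤-trans
    (x+γ≤y n (ℕ.m⊔n≤o⇒m≤o M N M⊔N≤n))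
    (≤-trans (-≥0 (solve 2 (λ y δ → (y :+ δ) :- y := δ) refl (seq y n) δ) (<⇒≤ 0<δ)) (y+δ≤z n (ℕ.m⊔n≤o⇒n≤o M N M⊔N≤n)))
    where open ℚ.+-*-Solver

  neg-mono : ∀ {m n} → m ℕ.≤ n → ℤ.- + n ℤ.≤ ℤ.- + m
  neg-mono m≤n = ℤ.neg-mono-≤ (ℤ.+≤+ m≤n)

  -- The conclusion with `d ∸ p` replaced by a variable `e`: it can then be proved for
  -- `d = suc q + e` and transported along an equation for `d`.
  RootsDescribed : (d p e : ℕ) → Set
  RootsDescribed d p e =
    Σ (Fin (p ∸ 1) → ℝ) λ α →
      (∀ i → fromℤ (ℤ.- (+ suc (toℕ i))) <ᴿ α i × α i <ᴿ fromℤ (ℤ.- (+ toℕ i))) ×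
      (∀ z → IsRoot (f d p) z ⇔
        ((∃ λ (k : ℕ) → 1 ℕ.≤ k × k ℕ.≤ e × z ≃ᶜ intᶜ (ℤ.- (+ k))) ⊎
         (∃ λ (i : Fin (p ∸ 1)) → z ≃ᶜ real (α i))))

  module _ (q e : ℕ) (q≤1+e : q ℕ.≤ suc e) where

    private
      d p : ℕ
      d = suc q ℕ.+ e
      p = suc q

      α : Fin q → ℝ
      α i = proj₁ (root-between {e} {q} (toℕ i) q≤1+e (toℕ<n i))

      α-lower : ∀ i → fromℤ (ℤ.- + suc (toℕ i)) <ᴿ α i
      α-lower i = proj₁ (proj₂ (root-between {e} {q} (toℕ i) q≤1+e (toℕ<n i)))

      α-upper : ∀ i → α i <ᴿ fromℤ (ℤ.- + toℕ i)
      α-upper i = proj₁ (proj₂ (proj₂ (root-between {e} {q} (toℕ i) q≤1+e (toℕ<n i))))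

      α-root : ∀ i → IsRoot (f d p) (real (α i))
      α-root i = fℚ-null⇒root d p (α i) (proj₂ (proj₂ (proj₂ (root-between {e} {q} (toℕ i) q≤1+e (toℕ<n i)))))

      integer-root : ∀ {k} → 1 ℕ.≤ k → k ℕ.≤ e → IsRoot (f d p) (intᶜ (ℤ.- + k))
      integer-root {k} 1≤k k≤e = fℚ-null⇒root d p (fromℤ (ℤ.- + k)) (null-cong (λ _ → sym f≡0) null-0)
        where
        f≡0 : fℚ d p ((ℤ.- + k) / 1) ≡ 0ℚ
        f≡0 = trans (fℚ-factor e q ((ℤ.- + k) / 1))
          (trans (cong (_* cofactor e q ((ℤ.- + k) / 1)) (trans (cong (rise e) (sym (minus≡ k))) (rise-vanishes 1≤k k≤e)))
            (*-zeroˡ (cofactor e q ((ℤ.- + k) / 1))))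

      0<f0 : 0ℚ < fℚ d p 0ℚ
      0<f0 = subst (0ℚ <_) (sym (fℚ-factor e q 0ℚ)) (0<* (rise-pos e 0ℚ ≤-refl)
        (subst (0ℚ <_) (*-identityˡ (cofactor e q 0ℚ)) (cofactor-sign′ {e} {q} {0} q≤1+e z≤n)))

      -- Provides the base point `z₀` at which `f` is known not to vanish, so that the constant left
      -- after dividing out the roots is cancellable.
      f0-cancellable : Cancellable (f d p (ratᶜ 0ℚ))
      f0-cancellable = re-apart⇒cancellable (fℚ d p 0ℚ) 0 0<f0 λ n _ →
        ≤-trans (≤-reflexive (sym (re-at (at-f d p (fromℚ 0ℚ) n)))) (p≤∣p∣ (seq (re (f d p (ratᶜ 0ℚ))) n))

      integers : List ℂ
      integers = tabulate {n = e} (λ i → intᶜ (ℤ.- + suc (toℕ i)))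

      αs : List ℂ
      αs = tabulate (real ∘ α)

      degree : length (integers ++ αs) ≡ q ℕ.+ e
      degree = trans (length-++ integers)
        (trans (cong₂ ℕ._+_ (length-tabulate (λ i → intᶜ (ℤ.- + suc (toℕ i)))) (length-tabulate (real ∘ α))) (ℕ.+-comm e q))

      -- Comparing indices is enough: `α j < -j ≤ -(i + 1)` for `i < j`, and
      -- `-(i + 1) ≤ -(j + 1) < α j` for `j ≤ i`.
      integer-α-separated : ∀ (i : Fin e) (j : Fin q) → Separated (intᶜ (ℤ.- + suc (toℕ i))) (real (α j))
      integer-α-separated i j = compare (ℕ.<-≤-connex (toℕ i) (toℕ j))
        where
        compare : toℕ i ℕ.< toℕ j ⊎ toℕ j ℕ.≤ toℕ i → Separated (intᶜ (ℤ.- + suc (toℕ i))) (real (α j))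
        compare (inj₁ i<j) = Separated-sym (<ᴿ⇒Separated (<ᴿ-fromℤ-≤ (α-upper j) (neg-mono i<j)))
        compare (inj₂ j≤i) = <ᴿ⇒Separated (fromℤ-≤-<ᴿ (neg-mono (s≤s j≤i)) (α-lower j))

      separated : AllPairs Separated (integers ++ αs)
      separated = AllPairs.++⁺
        (AllPairs.tabulate⁺-< λ i<j → Separated-sym (<ᴿ⇒Separated (fromℤ-mono-< (ℤ.neg-mono-< (ℤ.+<+ (s≤s i<j))))))
        -- An integer separates any two of them: `α j < -j ≤ -(i + 1) < α i`.
        (AllPairs.tabulate⁺-< λ {i} {j} i<j → Separated-sym (<ᴿ⇒Separated
          (<ᴿ-trans (<ᴿ-fromℤ-≤ (α-upper j) (neg-mono i<j)) (α-lower i))))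
        (All.tabulate⁺ λ i → All.tabulate⁺ λ j → integer-α-separated i j)

      all-roots : All (IsRoot (f d p)) (integers ++ αs)
      all-roots = All.++⁺ (All.tabulate⁺ λ i → integer-root (s≤s z≤n) (toℕ<n i)) (All.tabulate⁺ α-root)

      listed : ∀ {z} → Any (z ≃ᶜ_) (integers ++ αs) →
        (∃ λ (k : ℕ) → 1 ℕ.≤ k × k ℕ.≤ e × z ≃ᶜ intᶜ (ℤ.- (+ k))) ⊎ (∃ λ (i : Fin q) → z ≃ᶜ real (α i))
      listed any = ⊎.map
        (λ any-integer → let i , z≃ = Any.tabulate⁻ any-integer in suc (toℕ i) , s≤s z≤n , toℕ<n i , z≃)
        Any.tabulate⁻ (Any.++⁻ integers any)

      root-resp : ∀ {z w} → z ≃ᶜ w → IsRoot (f d p) w → IsRoot (f d p) z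
      root-resp z≃w w-root = CommutativeRing.trans ℂ-commutativeRing (IsPoly-cong (q ℕ.+ e) (IsPoly-f q e) z≃w) w-root

    roots-described : RootsDescribed d p e
    roots-described = α , (λ i → α-lower i , α-upper i) , λ z → mk⇔
      (λ z-root → listed (roots-complete 0-not-cancellable {ratᶜ 0ℚ} {z} (integers ++ αs)
        (subst (λ n → IsPoly n (f d p)) (sym degree) (IsPoly-f q e)) separated all-roots f0-cancellable z-root))
      λ { (inj₁ (k , 1≤k , k≤e , z≃)) → root-resp z≃ (integer-root 1≤k k≤e)
        ; (inj₂ (i , z≃)) → root-resp z≃ (α-root i) }

  -- With `p = q + 1` the constants cancel: `d - 2(q + 1) + 2 = d - 2q`.
  d-2p+2≥0⇒ : ∀ {d q} → + 0 ℤ.≤ ((+ d) ℤ.- (+ 2) ℤ.* (+ suc q)) ℤ.+ (+ 2) → q ℕ.+ q ℕ.≤ d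
  d-2p+2≥0⇒ {d} {q} 0≤ = ℤ.drop‿+≤+ (ℤ.0≤i-j⇒j≤i (subst (+ 0 ℤ.≤_) eq 0≤))
    where
    open +-*-Solver
    eq : ((+ d) ℤ.- (+ 2) ℤ.* (+ suc q)) ℤ.+ (+ 2) ≡ + d ℤ.- + (q ℕ.+ q)
    eq = trans (cong (λ t → ((+ d) ℤ.- (+ 2) ℤ.* t) ℤ.+ (+ 2)) (ℤ.pos-+ 1 q))
      (trans (solve 2 (λ d q → (d :- con (+ 2) :* (con (+ 1) :+ q)) :+ con (+ 2) := d :- (q :+ q)) refl (+ d) (+ q))
        (cong (λ t → + d ℤ.- t) (sym (ℤ.pos-+ q q))))

open import Data.Nat.Base using (ℕ; suc; _+_; _∸_; _≤_; _<_)
open import Data.Nat.Properties using (m+[n∸m]≡n; +-cancelˡ-≤; +-suc; <⇒≤)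
open import Data.Integer.Base as ℤ using (ℤ; +_)
open import Data.Fin.Base using (Fin; toℕ)
open import Data.Product.Base using (∃; Σ; _×_)
open import Data.Sum.Base using (_⊎_)
open import Function.Bundles using (_⇔_)
open import Relation.Binary.PropositionalEquality using (_≡_; sym; trans; subst)
open RootSet

theorem2p6 : (d p : ℕ) → p < d → 2 ≤ p →
    (+ 0) ℤ.≤ ((+ d) ℤ.- (+ 2) ℤ.* (+ p)) ℤ.+ (+ 2) →
    Σ (Fin (p ∸ 1) → ℝ) λ α →
    (∀ i → fromℤ (ℤ.- (+ suc (toℕ i))) <ᴿ α i × α i <ᴿ fromℤ (ℤ.- (+ toℕ i))) ×
    (∀ z → IsRoot (f d p) z ⇔
    ((∃ λ (k : ℕ) → 1 ≤ k × k ≤ d ∸ p × z ≃ᶜ intᶜ (ℤ.- (+ k))) ⊎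
    (∃ λ (i : Fin (p ∸ 1)) → z ≃ᶜ real (α i))))
theorem2p6 d (suc q) p<d _ 0≤d-2p+2 =
  subst (λ d′ → RootsDescribed d′ (suc q) e) q+1+e≡d (roots-described q e q≤1+e)
  where
  e : ℕ
  e = d ∸ suc q
  q+1+e≡d : suc q + e ≡ d
  q+1+e≡d = m+[n∸m]≡n (<⇒≤ p<d)
  -- From `q + q ≤ d = q + suc e` by cancelling `q`.
  q≤1+e : q ≤ suc e
  q≤1+e = +-cancelˡ-≤ q q (suc e)
    (subst (q + q ≤_) (sym (trans (+-suc q e) q+1+e≡d)) (d-2p+2≥0⇒ {d} {q} 0≤d-2p+2))
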